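{- The equational theories $\mathsf{ACU}$, $\mathcal{FL}_0$, and $\mathsf{ACUh}$ each have unrestricted unification type infinitary for elementary unification.
   Context: The theories. $\mathsf{ACU}=\{f(x,f(y,z))\approx f(f(x,y),z),\ f(x,y)\approx f(y,x),\ f(x,0)\approx x\}$, where $f$ is a binary symbol and $0$ a constant. $\mathsf{ACUh}$ extends $\mathsf{ACU}$ by finitely many (at least one) unary function symbols $h$, each with the identities $h(f(x,y))\approx f(h(x),h(y))$ and $h(0)\approx 0$. $\mathcal{FL}_0$ (which axiomatizes equivalence of concepts in the description logic $\mathcal{FL}_0$, with $f$ playing the role of conjunction, $0$ of $\top$, and the unary symbols of value restrictions $\forall r.$) is $\mathsf{ACUh}$ together with the identity $f(x,x)\approx x$, with as many unary symbols $h$ as there are role names (finitely many, at least one). In each case the signature $\Sigma$ consists of exactly the symbols occurring in the theory. Let $V$ be a countably infinite set of variables and $T(\Sigma,V)$ the set of terms. For an equational theory $E$, i.e., a set of (implicitly universally quantified) identities between terms, $\approx_E$ is the congruence relation on $T(\Sigma,V)$ it induces ($s\approx_E t$ iff $s\approx t$ holds in all models of $E$). A substitution is a map $\sigma:V\to T(\Sigma,V)$ with finite domain $\{x\in V\mid\sigma(x)\neq x\}$, extended homomorphically to terms. The unrestricted instantiation preorder $\leq_E^V$ is defined by: $\sigma\leq_E^V\tau$ iff there is a substitution $\lambda$ with $\lambda(\sigma(x))\approx_E\tau(x)$ for all $x\in V$. An $E$-unification problem is a finite set $\Gamma=\{s_1\approx_E^? t_1,\ldots,s_n\approx_E^? t_n\}$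 of equations between terms in $T(\Sigma,V)$; elementary unification means that $\Sigma$ contains only function symbols occurring in $E$. An $E$-unifier of $\Gamma$ is a substitution $\sigma$ with $\sigma(s_i)\approx_E\sigma(t_i)$ for all $i$; $\Gamma$ is solvable if it has an $E$-unifier. A set $S$ of $E$-unifiers of $\Gamma$ is complete w.r.t. $\leq_E^V$ if for every $E$-unifier $\theta$ of $\Gamma$ there is $\sigma\in S$ with $\sigma\leq_E^V\theta$; it is minimal if no two distinct elements of $S$ are comparable w.r.t. $\leq_E^V$. Minimal complete sets of the same problem all have the same cardinality. The unrestricted unification type of a solvable $\Gamma$ is: unitary if $\Gamma$ has a minimal complete set (w.r.t. $\leq_E^V$) of cardinality one; finitary if it has a finite minimal complete set of cardinality greater than one; infinitary if it has an infinite minimal complete set; zero if it has no minimal complete set. Types are ordered by zero $>$ infinitary $>$ finitary $>$ unitary, and the unrestricted unification type of $E$ is the largest (worst) unrestricted type of any solvable $E$-unification problem. -}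

module Defs where

open import Data.Fin using (Fin)
open import Data.List using (List)
open import Data.List.Membership.Propositional using (_∈_)
open import Data.List.Relation.Unary.All using (All)
open import Data.Nat using (ℕ; _≤_; _<_)
open import Data.Product using (∃; ∃-syntax; _×_; _,_; proj₁)
open import Data.Vec using (Vec; []; _∷_)
open import Data.Vec.Relation.Binary.Pointwise.Inductive using (Pointwise)
open import Function.Bundles using (Inverse)
open import Level using (0ℓ)
open import Relation.Binary.Bundles using (Setoid)
import Relation.Binary.Construct.On as On
open import Relation.Binary.Core using (Rel)
open import Relation.Binary.PropositionalEquality
  using (_≡_; _≢_; _≗_; _→-setoid_; setoid)
open import Relation.Nullary using (¬_)
open import Relation.Unary using (Pred)

------------------------------------------------------------------------
-- Terms and equational theories

record Signature : Set₁ where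
  field
    Op    : Set
    arity : Op → ℕ

open Signature public

V : Set
V = ℕ

data Term (Sg : Signature) : Set where
  var : V → Term Sg
  op  : (o : Op Sg) → Vec (Term Sg) (arity Sg o) → Term Sg

mutual
  infixl 20 _[_] _[_]*

  _[_] : ∀ {Sg} → Term Sg → (V → Term Sg) → Term Sg
  var x   [ ρ ] = ρ x
  op o ts [ ρ ] = op o (ts [ ρ ]*)

  _[_]* : ∀ {Sg n} → Vec (Term Sg) n → (V → Term Sg) → Vec (Term Sg) n
  []       [ ρ ]* = []
  (t ∷ ts) [ ρ ]* = (t [ ρ ]) ∷ (ts [ ρ ]*)

-- A set of identities: E s t means that the identity s ≈ t belongs to E.
Theory : Signature → Set₁
Theory Sg = Rel (Term Sg) 0ℓ

-- Since identities are implicitly universally quantified, all instances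
-- of identities in E are included.
infix 4 _⊢_≈_

data _⊢_≈_ {Sg} (E : Theory Sg) : Term Sg → Term Sg → Set where
  ax    : ∀ {s t} → E s t → (ρ : V → Term Sg) → E ⊢ s [ ρ ] ≈ t [ ρ ]
  refl  : ∀ {t} → E ⊢ t ≈ t
  sym   : ∀ {s t} → E ⊢ s ≈ t → E ⊢ t ≈ s
  trans : ∀ {s t u} → E ⊢ s ≈ t → E ⊢ t ≈ u → E ⊢ s ≈ u
  cong  : ∀ (o : Op Sg) {ss ts} →
          Pointwise (E ⊢_≈_) ss ts → E ⊢ op o ss ≈ op o ts

------------------------------------------------------------------------
-- Substitutions and the unrestricted instantiation preorder

FiniteDomain : ∀ {Sg} → (V → Term Sg) → Set
FiniteDomain σ = ∃[ xs ] (∀ x → σ x ≢ var x → x ∈ xs)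

record Subst (Sg : Signature) : Set where
  constructor mkSubst
  field
    app    : V → Term Sg
    finite : FiniteDomain app

open Subst public

-- Substitutions are equal when they are equal as maps; the witness of
-- finiteness of the domain is disregarded.
Subst-setoid : Signature → Setoid 0ℓ 0ℓ
Subst-setoid Sg = On.setoid (V →-setoid Term Sg) app

infix 4 _⊢_≲_

_⊢_≲_ : ∀ {Sg} → Theory Sg → Rel (Subst Sg) 0ℓ
_⊢_≲_ {Sg} E σ τ =
  ∃[ λ′ ] (∀ x → E ⊢ (app σ x [ app {Sg} λ′ ]) ≈ app τ x)

------------------------------------------------------------------------
-- Unification problems

Problem : Signature → Set
Problem Sg = List (Term Sg × Term Sg)

module _ {Sg : Signature} (E : Theory Sg) (Γ : Problem Sg) where

  Unifier : Pred (Subst Sg) 0ℓ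
  Unifier σ = All (λ (s , t) → E ⊢ s [ app σ ] ≈ t [ app σ ]) Γ

  Solvable : Set
  Solvable = ∃ Unifier

  Complete : Pred (Subst Sg) 0ℓ → Set
  Complete S = ∀ θ → Unifier θ → ∃[ σ ] (S σ × E ⊢ σ ≲ θ)

  Minimal : Pred (Subst Sg) 0ℓ → Set
  Minimal S = ∀ {σ τ} → S σ → S τ → ¬ (app σ ≗ app τ) → ¬ (E ⊢ σ ≲ τ)

  MinimalCompleteSet : Pred (Subst Sg) 0ℓ → Set
  MinimalCompleteSet S =
    (∀ {σ} → S σ → Unifier σ) × Complete S × Minimal S

HasCardinality : ∀ {Sg} → Pred (Subst Sg) 0ℓ → ℕ → Set
HasCardinality {Sg} S n =
  Inverse (On.setoid (Subst-setoid Sg) (proj₁ {B = S})) (setoid (Fin n))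

Infinite : ∀ {Sg} → Pred (Subst Sg) 0ℓ → Set
Infinite S = ¬ (∃[ n ] HasCardinality S n)

------------------------------------------------------------------------
-- Unification types

data UnificationType : Set where
  unitary finitary infinitary zero : UnificationType

-- Larger means worse.
rank : UnificationType → ℕ
rank unitary    = 0
rank finitary   = 1
rank infinitary = 2
rank zero       = 3

-- The type of the problem Γ; meaningful only for solvable Γ.
ProblemHasType : ∀ {Sg} → Theory Sg → Problem Sg → UnificationType → Set₁
ProblemHasType E Γ unitary =
  ∃[ S ] (MinimalCompleteSet E Γ S × HasCardinality S 1)
ProblemHasType E Γ finitary =
  ∃[ S ] (MinimalCompleteSet E Γ S × ∃[ n ] (1 < n × HasCardinality S n))
ProblemHasType E Γ infinitary =
  ∃[ S ] (MinimalCompleteSet E Γ S × Infinite S)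
ProblemHasType E Γ zero =
  ¬ (∃[ S ] MinimalCompleteSet E Γ S)

-- The unrestricted type of E for elementary unification: problems are
-- built over the signature of E only, and t is the largest type of a
-- solvable problem.
TheoryHasType : ∀ {Sg} → Theory Sg → UnificationType → Set₁
TheoryHasType {Sg} E t =
  (∃[ Γ ] (Solvable E Γ × ProblemHasType E Γ t)) ×
  (∀ (Γ : Problem Sg) → Solvable E Γ →
   ∀ t′ → ProblemHasType E Γ t′ → rank t′ ≤ rank t)

------------------------------------------------------------------------
-- The theories

-- The signature with f, 0 and r unary symbols.
data Symbol (r : ℕ) : Set where
  f 𝟘 : Symbol r
  h   : Fin r → Symbol r

Sig : ℕ → Signature
Sig r .Op        = Symbol r
Sig r .arity f   = 2
Sig r .arity 𝟘   = 0
Sig r .arity (h _) = 1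

module _ {r : ℕ} where

  private
    f⟨_,_⟩ : Term (Sig r) → Term (Sig r) → Term (Sig r)
    f⟨ s , t ⟩ = op f (s ∷ t ∷ [])

    o : Term (Sig r)
    o = op 𝟘 []

    h⟨_⟩ : Fin r → Term (Sig r) → Term (Sig r)
    h⟨ i ⟩ t = op (h i) (t ∷ [])

    x y z : Term (Sig r)
    x = var 0
    y = var 1
    z = var 2

  data ACU-identities : Theory (Sig r) where
    assoc : ACU-identities f⟨ x , f⟨ y , z ⟩ ⟩ f⟨ f⟨ x , y ⟩ , z ⟩
    comm  : ACU-identities f⟨ x , y ⟩ f⟨ y , x ⟩
    unit  : ACU-identities f⟨ x , o ⟩ x

  data ACUh-identities : Theory (Sig r) where
    acu    : ∀ {s t} → ACU-identities s t → ACUh-identities s t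
    h-homo : ∀ i → ACUh-identities (h⟨ i ⟩ f⟨ x , y ⟩) f⟨ h⟨ i ⟩ x , h⟨ i ⟩ y ⟩
    h-zero : ∀ i → ACUh-identities (h⟨ i ⟩ o) o

  data FL₀-identities : Theory (Sig r) where
    acuh : ∀ {s t} → ACUh-identities s t → FL₀-identities s t
    idem : FL₀-identities f⟨ x , x ⟩ x

ACU : Theory (Sig 0)
ACU = ACU-identities

-- r is the number of unary symbols; the theories are only considered
-- for r ≥ 1.
ACUh FL₀ : (r : ℕ) → Theory (Sig r)
ACUh r = ACUh-identities
FL₀  r = FL₀-identities

{-# OPTIONS --safe #-}
module Submission where

-- A witness ρ of σ ≲ τ maps almost all variables to themselves and, if τ is the identity
-- from n on, has every variable p ≥ n in its image; hence up to a permutation ρ fixes those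
-- p, and it erases at most n variables. Given a unifier σ, go down to one below which the
-- number e of erasable variables cannot drop any further. Then below every unifier σ₁ ≲ σ
-- there is a unifier that reaches σ by a witness erasing nothing, and there are only finitely
-- many such unifiers up to equivalence. A minimal one among them is a minimal unifier, so
-- every problem has a minimal complete set.
--
-- For the infinite one, consider x₀ + x₁ ≈ x₂ + x₃ + x₄, whose solutions need one parameter
-- more than there are variables. Borrowing the missing one from outside the problem gives
-- solutions from which every witness hits all variables, so that it is a permutation and the
-- solution is minimal; distinct borrowed variables give incomparable solutions.

open import Defs
open import Axiom.ExcludedMiddle using (ExcludedMiddle)
open import Data.Fin as Fin using (Fin)
import Data.Fin.Properties as Fin
open import Data.List
  using (List; []; _∷_; _++_; map; length; upTo; allFin; cartesianProduct; cartesianProductWith; foldr)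
import Data.List.Properties as List
open import Data.List.Membership.Propositional using (_∈_; _∉_)
import Data.List.Membership.DecPropositional as DecMembership
open import Data.List.Membership.Propositional.Properties
open import Data.List.Relation.Binary.Permutation.Propositional
  using (_↭_; prep; swap; ↭-refl; ↭-sym; ↭-trans; ↭-reflexive)
import Data.List.Relation.Binary.Permutation.Propositional.Properties as Perm
open import Data.List.Relation.Binary.Subset.Propositional using (_⊆_)
import Data.List.Relation.Binary.Subset.Propositional.Properties as Subset
open import Data.List.Relation.Unary.All using (All; []; _∷_)
import Data.List.Relation.Unary.All as All
open import Data.List.Relation.Unary.Any using (here; there; any?)
open import Data.List.Relation.Unary.Unique.Propositional using (Unique; []; _∷_)
import Data.List.Relation.Unary.Unique.Propositional.Properties as Unique
open import Data.Nat using (ℕ; zero; suc; _+_; _⊔_; _≤_; _<_; z≤n; s≤s; NonZero)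
open import Data.Nat.Induction using (<-rec)
import Data.Nat.Properties as ℕ
open import Data.Product using (∃; ∃-syntax; _×_; _,_; proj₁; proj₂)
import Data.Product.Properties as Product
open import Data.Sum using (inj₁; inj₂; [_,_]′)
open import Data.Vec using (Vec; []; _∷_)
open import Data.Vec.Relation.Binary.Pointwise.Inductive using (Pointwise; []; _∷_)
open import Function using (_∘_)
open import Function.Bundles using (Inverse)
open import Level using (0ℓ)
open import Relation.Binary.Bundles using (Setoid)
import Relation.Binary.Reasoning.Setoid as SetoidReasoning
open import Relation.Binary.PropositionalEquality as ≡ using (_≡_; _≢_; refl)
open import Relation.Nullary using (¬_; Dec; yes; no; contradiction)
open import Relation.Nullary.Decidable using (decidable-stable; from-yes; from-no; _→-dec_)
open import Relation.Unary using (Pred)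

-- Substitution calculus and substitutions that are eventually the identity.

bound : ∀ (xs : List ℕ) → ∃[ n ] (∀ {x} → x ∈ xs → x < n)
bound []       = 0 , λ ()
bound (x ∷ xs) with n , xs<n ← bound xs = suc x ⊔ n , λ
  { (here refl) → ℕ.m≤m⊔n (suc x) n
  ; (there y∈)  → ℕ.≤-trans (xs<n y∈) (ℕ.m≤n⊔m (suc x) n) }

module _ {Sg : Signature} where

  mutual
    []-∘ : ∀ (t : Term Sg) {ρ κ} → t [ ρ ] [ κ ] ≡ t [ (λ x → ρ x [ κ ]) ]
    []-∘ (var _)   = refl
    []-∘ (op o ts) = ≡.cong (op o) ([]*-∘ ts)

    []*-∘ : ∀ {n} (ts : Vec (Term Sg) n) {ρ κ} → ts [ ρ ]* [ κ ]* ≡ ts [ (λ x → ρ x [ κ ]) ]*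
    []*-∘ []       = refl
    []*-∘ (t ∷ ts) = ≡.cong₂ _∷_ ([]-∘ t) ([]*-∘ ts)

  mutual
    []-var : ∀ (t : Term Sg) → t [ var ] ≡ t
    []-var (var _)   = refl
    []-var (op o ts) = ≡.cong (op o) ([]*-var ts)

    []*-var : ∀ {n} (ts : Vec (Term Sg) n) → ts [ var ]* ≡ ts
    []*-var []       = refl
    []*-var (t ∷ ts) = ≡.cong₂ _∷_ ([]-var t) ([]*-var ts)

  module _ {E : Theory Sg} where

    ≈-reflexive : ∀ {s t} → s ≡ t → E ⊢ s ≈ t
    ≈-reflexive refl = refl

    mutual
      ≈-[] : ∀ {s t} κ → E ⊢ s ≈ t → E ⊢ s [ κ ] ≈ t [ κ ]
      ≈-[] κ (ax {s} {t} e ρ) =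
        trans (≈-reflexive ([]-∘ s)) (trans (ax e _) (≈-reflexive (≡.sym ([]-∘ t))))
      ≈-[] κ refl        = refl
      ≈-[] κ (sym p)     = sym (≈-[] κ p)
      ≈-[] κ (trans p q) = trans (≈-[] κ p) (≈-[] κ q)
      ≈-[] κ (cong o ps) = cong o (≈-[]* κ ps)

      ≈-[]* : ∀ {n} {ss ts : Vec (Term Sg) n} κ → Pointwise (E ⊢_≈_) ss ts →
              Pointwise (E ⊢_≈_) (ss [ κ ]*) (ts [ κ ]*)
      ≈-[]* κ []       = []
      ≈-[]* κ (p ∷ ps) = ≈-[] κ p ∷ ≈-[]* κ ps

    mutual
      []-≈ : ∀ t {ρ κ} → (∀ x → E ⊢ ρ x ≈ κ x) → E ⊢ t [ ρ ] ≈ t [ κ ]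
      []-≈ (var x)   p = p x
      []-≈ (op o ts) p = cong o ([]*-≈ ts p)

      []*-≈ : ∀ {n} (ts : Vec (Term Sg) n) {ρ κ} → (∀ x → E ⊢ ρ x ≈ κ x) →
              Pointwise (E ⊢_≈_) (ts [ ρ ]*) (ts [ κ ]*)
      []*-≈ []       p = []
      []*-≈ (t ∷ ts) p = []-≈ t p ∷ []*-≈ ts p

  -- Variables are numbers, so a finite domain lies below some bound; in this form domains compose
  -- and can be counted.
  IdFrom : ℕ → Pred (V → Term Sg) 0ℓ
  IdFrom n σ = ∀ x → n ≤ x → σ x ≡ var x

  subst : ∀ {n} (σ : V → Term Sg) → IdFrom n σ → Subst Sg
  subst {n} σ σ-id = mkSubst σ (upTo n , λ x σx≢x → ∈-upTo⁺ (ℕ.≰⇒> (σx≢x ∘ σ-id x)))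

  idSubst : Subst Sg
  idSubst = subst {0} var (λ _ _ → refl)

-- The list of monomials of a term.

tuples : ∀ {A : Set} → List A → ℕ → List (List A)
tuples as zero    = [] ∷ []
tuples as (suc n) = [] ∷ cartesianProductWith _∷_ as (tuples as n)

∈-tuples : ∀ {A : Set} {as : List A} {n} xs → All (_∈ as) xs → length xs ≤ n → xs ∈ tuples as n
∈-tuples {n = zero}  []       _          _         = here refl
∈-tuples {n = suc n} []       _          _         = here refl
∈-tuples {n = suc n} (x ∷ xs) (x∈ ∷ xs∈) (s≤s len) =
  there (∈-cartesianProductWith⁺ _∷_ x∈ (∈-tuples xs xs∈ len))

module Monomials {r : ℕ} where

  T : Set
  T = Term (Sig r)

  infixl 6 _⊕_

  _⊕_ : T → T → T
  s ⊕ t = op f (s ∷ t ∷ [])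

  O : T
  O = op 𝟘 []

  H : Fin r → T → T
  H i t = op (h i) (t ∷ [])

  -- (i₁ ∷ … ∷ iₖ ∷ [] , x) stands for h i₁ (… (h iₖ x)).
  Monomial : Set
  Monomial = List (Fin r) × V

  _·_ : Fin r → Monomial → Monomial
  i · (w , x) = i ∷ w , x

  mon : T → List Monomial
  mon (var x)              = ([] , x) ∷ []
  mon (op f (s ∷ t ∷ []))  = mon s ++ mon t
  mon (op 𝟘 [])            = []
  mon (op (h i) (t ∷ []))  = map (i ·_) (mon t)

  _∈ᵐ?_ : ∀ (m : Monomial) l → Dec (m ∈ l)
  _∈ᵐ?_ = DecMembership._∈?_ (Product.≡-dec (List.≡-dec Fin._≟_) ℕ._≟_)

  mono : Monomial → T
  mono (w , x) = foldr H (var x) w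

  Σ⟦_⟧ : List Monomial → T
  Σ⟦_⟧ = foldr (λ m t → mono m ⊕ t) O

  mon-[]⁺ : ∀ t {ρ w w′ x y} → (w , x) ∈ mon t → (w′ , y) ∈ mon (ρ x) →
            (w ++ w′ , y) ∈ mon (t [ ρ ])
  mon-[]⁺ (var x) (here refl) q = q
  mon-[]⁺ (op f (s ∷ t ∷ [])) {ρ} p q with ∈-++⁻ (mon s) p
  ... | inj₁ p′ = ∈-++⁺ˡ (mon-[]⁺ s p′ q)
  ... | inj₂ p′ = ∈-++⁺ʳ (mon (s [ ρ ])) (mon-[]⁺ t p′ q)
  mon-[]⁺ (op 𝟘 []) ()
  mon-[]⁺ (op (h i) (t ∷ [])) p q with ∈-map⁻ (i ·_) p
  ... | _ , p′ , refl = ∈-map⁺ (i ·_) (mon-[]⁺ t p′ q)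

  mon-[]⁻ : ∀ t {ρ v y} → (v , y) ∈ mon (t [ ρ ]) →
            ∃[ w ] ∃[ w′ ] ∃[ x ] (v ≡ w ++ w′ × (w , x) ∈ mon t × (w′ , y) ∈ mon (ρ x))
  mon-[]⁻ (var x) p = [] , _ , x , refl , here refl , p
  mon-[]⁻ (op f (s ∷ t ∷ [])) {ρ} p with ∈-++⁻ (mon (s [ ρ ])) p
  ... | inj₁ p′ with w , w′ , x , e , q , q′ ← mon-[]⁻ s p′ =
    w , w′ , x , e , ∈-++⁺ˡ q , q′
  ... | inj₂ p′ with w , w′ , x , e , q , q′ ← mon-[]⁻ t p′ =
    w , w′ , x , e , ∈-++⁺ʳ (mon s) q , q′
  mon-[]⁻ (op 𝟘 []) ()
  mon-[]⁻ (op (h i) (t ∷ [])) p with ∈-map⁻ (i ·_) p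
  ... | _ , p′ , refl with w , w′ , x , refl , q , q′ ← mon-[]⁻ t p′ =
    i ∷ w , w′ , x , refl , ∈-map⁺ (i ·_) q , q′

  _∈ᵛ_ : V → T → Set
  x ∈ᵛ t = ∃[ w ] (w , x) ∈ mon t

  NonErasing : Pred (V → T) 0ℓ
  NonErasing ρ = ∀ x → ∃[ y ] y ∈ᵛ ρ x

  -- Every monomial of `t` gives rise to at least one monomial of the instance, and lists keep
  -- multiplicities, so the size of the instance bounds that of `t`.
  length-mon-[] : ∀ t {ρ} → NonErasing ρ → length (mon t) ≤ length (mon (t [ ρ ]))
  length-mon-[] (var x) {ρ} ne with mon (ρ x) | ne x
  ... | _ ∷ _ | _ = s≤s z≤n
  length-mon-[] (op f (s ∷ t ∷ [])) {ρ} ne = begin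
    length (mon s ++ mon t)                              ≡⟨ List.length-++ (mon s) ⟩
    length (mon s) + length (mon t)                      ≤⟨ ℕ.+-mono-≤ (length-mon-[] s ne) (length-mon-[] t ne) ⟩
    length (mon (s [ ρ ])) + length (mon (t [ ρ ]))      ≡⟨ List.length-++ (mon (s [ ρ ])) ⟨
    length (mon (s [ ρ ]) ++ mon (t [ ρ ]))              ∎
    where open ℕ.≤-Reasoning
  length-mon-[] (op 𝟘 []) ne = z≤n
  length-mon-[] (op (h i) (t ∷ [])) {ρ} ne = begin
    length (map (i ·_) (mon t))          ≡⟨ List.length-map (i ·_) (mon t) ⟩
    length (mon t)                       ≤⟨ length-mon-[] t ne ⟩
    length (mon (t [ ρ ]))               ≡⟨ List.length-map (i ·_) (mon (t [ ρ ])) ⟨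
    length (map (i ·_) (mon (t [ ρ ])))  ∎
    where open ℕ.≤-Reasoning

  Small : ℕ → Pred Monomial 0ℓ
  Small n (w , x) = length w ≤ n × x < n

  alphabet : ℕ → List Monomial
  alphabet n = cartesianProduct (tuples (allFin r) n) (upTo n)

  ∈-alphabet : ∀ {n m} → Small n m → m ∈ alphabet n
  ∈-alphabet {m = w , x} (len , x<n) =
    ∈-cartesianProduct⁺ (∈-tuples w (All.universal ∈-allFin w) len) (∈-upTo⁺ x<n)

  override : List T → (V → T) → V → T
  override []       ρ x       = ρ x
  override (t ∷ ts) ρ zero    = t
  override (t ∷ ts) ρ (suc x) = override ts (ρ ∘ suc) x

  override-≥ : ∀ ts {ρ} x → length ts ≤ x → override ts ρ x ≡ ρ x
  override-≥ []       x       _         = refl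
  override-≥ (t ∷ ts) (suc x) (s≤s len) = override-≥ ts x len

unique⊆⇒length≤ : ∀ {A : Set} {xs ys : List A} → Unique xs → xs ⊆ ys → length xs ≤ length ys
unique⊆⇒length≤ [] _ = z≤n
unique⊆⇒length≤ {xs = x ∷ xs} (x∉xs ∷ uniq) sub with ys , zs , refl ← ∈-∃++ (sub (here refl)) =
  begin
    suc (length xs)                ≤⟨ s≤s (unique⊆⇒length≤ uniq sub′) ⟩
    suc (length (ys ++ zs))        ≡⟨ Perm.↭-length (Perm.shift x ys zs) ⟨
    length (ys ++ x ∷ zs)          ∎
  where
  open ℕ.≤-Reasoning
  sub′ : xs ⊆ ys ++ zs
  sub′ y∈ with Perm.∈-resp-↭ (Perm.shift x ys zs) (sub (there y∈))
  ... | here refl = contradiction refl (All.lookup x∉xs y∈)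
  ... | there p   = p

-- What the argument requires of a theory.

open Monomials

-- The summand `n` serves the theories that count multiplicities, where `≈` preserves the number of
-- monomials. The other serves `FL₀`, where duplicate-free lists of small monomials are no longer
-- than the alphabet.
capacity : ∀ (r n : ℕ) → ℕ
capacity r n = n + length (alphabet {r} n)

-- A common interface for multiset semantics (`ACU`, `ACUh`) and set semantics (`FL₀`). `single` is
-- a weak form of cancellation: where multiplicities count, absence of `x` from `t` forces
-- multiplicity one in `s`. `compress` bounds a term by its image under a non-erasing substitution.
record Adequate {r : ℕ} (E : Theory (Sig r)) : Set where
  field
    acuh-ax  : ∀ {s t} → ACUh-identities s t → ∀ ρ → E ⊢ s [ ρ ] ≈ t [ ρ ]
    sound    : ∀ {s t} → E ⊢ s ≈ t → mon s ⊆ mon t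
    single   : ∀ s u t x → E ⊢ s ⊕ u ≈ var x ⊕ t → ([] , x) ∈ mon s →
               mon s ⊆ ([] , x) ∷ [] → ([] , x) ∉ mon t → E ⊢ s ≈ var x
    compress : ∀ n s t ρ → NonErasing ρ → E ⊢ t [ ρ ] ≈ s → length (mon s) ≤ n →
               All (Small n) (mon t) →
               ∃[ l ] (E ⊢ t ≈ Σ⟦ l ⟧ × All (Small n) l × length l ≤ capacity r n)

-- Every term is a sum of monomials.

module Sums {r : ℕ} {E : Theory (Sig r)}
  (acuh-ax : ∀ {s t} → ACUh-identities s t → ∀ ρ → E ⊢ s [ ρ ] ≈ t [ ρ ]) where

  ≈-setoid : Setoid 0ℓ 0ℓ
  ≈-setoid = record
    { Carrier = T {r} ; _≈_ = E ⊢_≈_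
    ; isEquivalence = record { refl = refl ; sym = sym ; trans = trans } }

  open SetoidReasoning ≈-setoid

  ⊕-cong : ∀ {s s′ t t′} → E ⊢ s ≈ s′ → E ⊢ t ≈ t′ → E ⊢ s ⊕ t ≈ s′ ⊕ t′
  ⊕-cong p q = cong f (p ∷ q ∷ [])

  H-cong : ∀ i {s t} → E ⊢ s ≈ t → E ⊢ H i s ≈ H i t
  H-cong i p = cong (h i) (p ∷ [])

  ⊕-assoc : ∀ s t u → E ⊢ s ⊕ t ⊕ u ≈ s ⊕ (t ⊕ u)
  ⊕-assoc s t u = sym (acuh-ax (acu assoc) (override (s ∷ t ∷ u ∷ []) var))

  ⊕-comm : ∀ s t → E ⊢ s ⊕ t ≈ t ⊕ s
  ⊕-comm s t = acuh-ax (acu comm) (override (s ∷ t ∷ []) var)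

  ⊕-identityʳ : ∀ s → E ⊢ s ⊕ O ≈ s
  ⊕-identityʳ s = acuh-ax (acu unit) (override (s ∷ []) var)

  ⊕-identityˡ : ∀ s → E ⊢ O ⊕ s ≈ s
  ⊕-identityˡ s = trans (⊕-comm O s) (⊕-identityʳ s)

  H-⊕ : ∀ i s t → E ⊢ H i (s ⊕ t) ≈ H i s ⊕ H i t
  H-⊕ i s t = acuh-ax (h-homo i) (override (s ∷ t ∷ []) var)

  H-O : ∀ i → E ⊢ H i O ≈ O
  H-O i = acuh-ax (h-zero i) var

  Σ-++ : ∀ l l′ → E ⊢ Σ⟦ l ++ l′ ⟧ ≈ Σ⟦ l ⟧ ⊕ Σ⟦ l′ ⟧
  Σ-++ []      l′ = sym (⊕-identityˡ _)
  Σ-++ (m ∷ l) l′ = trans (⊕-cong refl (Σ-++ l l′)) (sym (⊕-assoc _ _ _))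

  Σ-map : ∀ i l → E ⊢ Σ⟦ map (i ·_) l ⟧ ≈ H i Σ⟦ l ⟧
  Σ-map i []      = sym (H-O i)
  Σ-map i (m ∷ l) = trans (⊕-cong refl (Σ-map i l)) (sym (H-⊕ i _ _))

  Σ-mon : ∀ t → E ⊢ t ≈ Σ⟦ mon t ⟧
  Σ-mon (var x)             = sym (⊕-identityʳ _)
  Σ-mon (op f (s ∷ t ∷ [])) = trans (⊕-cong (Σ-mon s) (Σ-mon t)) (sym (Σ-++ (mon s) (mon t)))
  Σ-mon (op 𝟘 [])           = refl
  Σ-mon (op (h i) (t ∷ [])) = trans (H-cong i (Σ-mon t)) (sym (Σ-map i (mon t)))

  Σ-↭ : ∀ {l l′} → l ↭ l′ → E ⊢ Σ⟦ l ⟧ ≈ Σ⟦ l′ ⟧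
  Σ-↭ _↭_.refl          = refl
  Σ-↭ (prep m p)        = ⊕-cong refl (Σ-↭ p)
  Σ-↭ (swap m m′ p)     = begin
    mono m ⊕ (mono m′ ⊕ _)  ≈⟨ ⊕-assoc _ _ _ ⟨
    mono m ⊕ mono m′ ⊕ _    ≈⟨ ⊕-cong (⊕-comm _ _) (Σ-↭ p) ⟩
    mono m′ ⊕ mono m ⊕ _    ≈⟨ ⊕-assoc _ _ _ ⟩
    mono m′ ⊕ (mono m ⊕ _)  ∎
  Σ-↭ (_↭_.trans p q)   = trans (Σ-↭ p) (Σ-↭ q)

  ↭⇒≈ : ∀ s t → mon s ↭ mon t → E ⊢ s ≈ t
  ↭⇒≈ s t p = trans (Σ-mon s) (trans (Σ-↭ p) (sym (Σ-mon t)))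

  split : ∀ t {m} → m ∈ mon t → ∃[ u ] E ⊢ t ≈ mono m ⊕ u
  split t {m} m∈ with ys , zs , e ← ∈-∃++ m∈ =
    Σ⟦ ys ++ zs ⟧ , trans (Σ-mon t) (Σ-↭ (↭-trans (↭-reflexive e) (Perm.shift m ys zs)))

-- Permutations of the variables with finite support.

record Renaming : Set where
  field
    to from : V → V
    to-from : ∀ x → to (from x) ≡ x
    from-to : ∀ x → from (to x) ≡ x
    size    : ℕ
    to-≥    : ∀ x → size ≤ x → to x ≡ x

  from-≥ : ∀ x → size ≤ x → from x ≡ x
  from-≥ x p = ≡.trans (≡.cong from (≡.sym (to-≥ x p))) (from-to x)

  toˢ fromˢ : ∀ {Sg} → Subst Sg
  toˢ   = subst {n = size} (var ∘ to) (λ x p → ≡.cong var (to-≥ x p))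
  fromˢ = subst {n = size} (var ∘ from) (λ x p → ≡.cong var (from-≥ x p))

transpose : V → V → V → V
transpose x y z with z ℕ.≟ x | z ℕ.≟ y
... | yes _ | _     = y
... | no  _ | yes _ = x
... | no  _ | no  _ = z

transpose-fixed : ∀ {x y z} → z ≢ x → z ≢ y → transpose x y z ≡ z
transpose-fixed {x} {y} {z} z≢x z≢y with z ℕ.≟ x | z ℕ.≟ y
... | yes p | _     = contradiction p z≢x
... | no  _ | yes p = contradiction p z≢y
... | no  _ | no  _ = refl

transpose-right : ∀ x y → transpose x y y ≡ x
transpose-right x y with y ℕ.≟ x | y ℕ.≟ y
... | yes p | _     = p
... | no  _ | yes _ = refl
... | no  _ | no  p = contradiction refl p

transpose-left : ∀ x y → transpose x y x ≡ y
transpose-left x y with x ℕ.≟ x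
... | yes _ = refl
... | no  p = contradiction refl p

transpose-involutive : ∀ x y z → transpose x y (transpose x y z) ≡ z
transpose-involutive x y z with z ℕ.≟ x | z ℕ.≟ y
... | yes refl | _        = transpose-right x y
... | no  _    | yes refl = transpose-left x y
... | no  z≢x  | no  z≢y  = transpose-fixed z≢x z≢y

identity : Renaming
identity = record
  { to = λ x → x ; from = λ x → x ; to-from = λ _ → refl ; from-to = λ _ → refl
  ; size = 0 ; to-≥ = λ _ _ → refl }

transposeAfter : V → V → Renaming → Renaming
transposeAfter x y π = record
  { to      = transpose x y ∘ to
  ; from    = from ∘ transpose x y
  ; to-from = λ z → ≡.trans (≡.cong (transpose x y) (to-from _)) (transpose-involutive x y z)
  ; from-to = λ z → ≡.trans (≡.cong from (transpose-involutive x y _)) (from-to z)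
  ; size    = size ⊔ (suc x ⊔ suc y)
  ; to-≥    = λ z p → ≡.trans
      (≡.cong (transpose x y) (to-≥ z (ℕ.m⊔n≤o⇒m≤o size _ p)))
      (transpose-fixed
        (ℕ.>⇒≢ (ℕ.m⊔n≤o⇒m≤o (suc x) (suc y) (ℕ.m⊔n≤o⇒n≤o size _ p)))
        (ℕ.>⇒≢ (ℕ.m⊔n≤o⇒n≤o (suc x) (suc y) (ℕ.m⊔n≤o⇒n≤o size _ p))))
  }
  where open Renaming π

-- Composition, minimal elements and canonical representatives.

module _ {Sg : Signature} where

  idFrom : ExcludedMiddle 0ℓ → (σ : Subst Sg) → ∃[ n ] IdFrom n (app σ)
  idFrom em (mkSubst σ (xs , fin)) with n , xs<n ← bound xs =
    -- The domain list only refutes `σ x ≢ var x`; excluded middle turns this into an equation.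
    n , λ x n≤x → decidable-stable (em {σ x ≡ var x}) (λ σx≢x → ℕ.<⇒≱ (xs<n (fin x σx≢x)) n≤x)

  compose : ExcludedMiddle 0ℓ → Subst Sg → Subst Sg → Subst Sg
  compose em σ κ = subst {n = m ⊔ n} (λ x → app σ x [ app κ ]) (λ x p → ≡.trans
    (≡.cong (_[ app κ ]) (proj₂ (idFrom em σ) x (ℕ.m⊔n≤o⇒m≤o m n p)))
    (proj₂ (idFrom em κ) x (ℕ.m⊔n≤o⇒n≤o m n p)))
    where
    m = proj₁ (idFrom em σ)
    n = proj₁ (idFrom em κ)

module _ {A : Set} (em : ExcludedMiddle 0ℓ) {_≼_ : A → A → Set}
  (≼-refl : ∀ {a} → a ≼ a) (≼-trans : ∀ {a b c} → a ≼ b → b ≼ c → a ≼ c) where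

  finite⇒minimal : ∀ (l : List A) (Q : Pred A 0ℓ) →
    (∀ {a} → Q a → ∃[ b ] (b ∈ l × a ≼ b × b ≼ a)) → ∃ Q →
    ∃[ a ] (Q a × (∀ {b} → Q b → b ≼ a → a ≼ b))
  finite⇒minimal [] Q cover (a , qa) with cover qa
  ... | _ , () , _
  finite⇒minimal (c ∷ l) Q cover q
    with em {∃[ a ] (Q a × a ≼ c × ¬ c ≼ a)} | em {∃[ a ] (Q a × a ≼ c × c ≼ a)}
  ... | yes below | _ =
    let a , (qa , a≼c , c⋠a) , min = finite⇒minimal l (λ a → Q a × a ≼ c × ¬ c ≼ a) cover′ below
    in  a , qa , λ {b} qb b≼a →
          min (qb , ≼-trans b≼a a≼c , λ c≼b → c⋠a (≼-trans c≼b b≼a)) b≼a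
    where
    cover′ : ∀ {a} → Q a × a ≼ c × ¬ c ≼ a → ∃[ b ] (b ∈ l × a ≼ b × b ≼ a)
    cover′ (qa , a≼c , c⋠a) with cover qa
    ... | _ , here refl , a≼b , b≼a = contradiction b≼a c⋠a
    ... | b , there b∈  , a≼b , b≼a = b , b∈ , a≼b , b≼a
  ... | no none | yes (a , qa , a≼c , c≼a) =
    a , qa , λ {b} qb b≼a → ≼-trans a≼c
      (decidable-stable em (λ c⋠b → none (b , qb , ≼-trans b≼a a≼c , c⋠b)))
  ... | no _ | no none = finite⇒minimal l Q cover′ q
    where
    cover′ : ∀ {a} → Q a → ∃[ b ] (b ∈ l × a ≼ b × b ≼ a)
    cover′ qa with cover qa
    ... | _ , here refl , a≼b , b≼a = contradiction (_ , qa , a≼b , b≼a) none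
    ... | b , there b∈  , a≼b , b≼a = b , b∈ , a≼b , b≼a

module _ {A : Set} where

  data First (C : Pred A 0ℓ) : List A → A → Set where
    here  : ∀ {a l} → C a → First C (a ∷ l) a
    there : ∀ {a b l} → ¬ C a → First C l b → First C (a ∷ l) b

  first : ExcludedMiddle 0ℓ → ∀ {C : Pred A 0ℓ} {l a} → a ∈ l → C a → ∃[ b ] (First C l b × C b)
  first em {C} {x ∷ l} {a} a∈ ca with em {C x}
  ... | yes cx = x , here cx , cx
  ... | no ¬cx with a∈
  ...   | here refl = contradiction ca ¬cx
  ...   | there a∈l with b , p , cb ← first em a∈l ca = b , there ¬cx p , cb

  first-unique : ∀ {C C′ : Pred A 0ℓ} → (∀ {a} → C a → C′ a) → (∀ {a} → C′ a → C a) →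
                 ∀ {l a b} → First C l a → First C′ l b → a ≡ b
  first-unique to from (here _)    (here _)     = refl
  first-unique to from (here c)    (there ¬c _) = contradiction (to c) ¬c
  first-unique to from (there ¬c _) (here c)    = contradiction (from c) ¬c
  first-unique to from (there _ p) (there _ q)  = first-unique to from p q

  Least : (ℕ → Set) → ℕ → Set
  Least P n = P n × (∀ m → m < n → ¬ P m)

  least : ExcludedMiddle 0ℓ → ∀ {P : ℕ → Set} n → P n → ∃ (Least P)
  least em {P} = <-rec (λ n → P n → ∃ (Least P)) step
    where
    step : ∀ n → (∀ {m} → m < n → P m → ∃ (Least P)) → P n → ∃ (Least P)
    step n rec pn with em {∃[ m ] (m < n × P m)}
    ... | yes (m , m<n , pm) = rec m<n pm
    ... | no  none           = n , pn , λ m m<n pm → none (m , m<n , pm)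

  least-unique : ∀ {P P′ : ℕ → Set} → (∀ {n} → P n → P′ n) → (∀ {n} → P′ n → P n) →
                 ∀ {m n} → Least P m → Least P′ n → m ≡ n
  least-unique to from {m} {n} (pm , m-min) (pn , n-min) = ℕ.≤-antisym
    (ℕ.≮⇒≥ (λ n<m → m-min n n<m (from pn)))
    (ℕ.≮⇒≥ (λ m<n → n-min m m<n (to pm)))

  -- The first element satisfying C in the first list L n that has one. It depends only on
  -- the extension of C, so it picks representatives of equivalence classes without choice.
  Pick : (ℕ → List A) → Pred A 0ℓ → Pred A 0ℓ
  Pick L C a = ∃[ n ] (Least (λ m → ∃[ b ] (b ∈ L m × C b)) n × First C (L n) a)

  pick : ExcludedMiddle 0ℓ → ∀ {L C} n {a} → a ∈ L n → C a → ∃[ b ] (Pick L C b × C b)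
  pick em {L} {C} n a∈ ca
    with m , (l@((b , b∈ , cb) , _)) ← least em {λ m → ∃[ b ] (b ∈ L m × C b)} n (_ , a∈ , ca)
    with d , p , cd ← first em b∈ cb = d , (m , l , p) , cd

  pick-unique : ∀ {L} {C C′ : Pred A 0ℓ} → (∀ {a} → C a → C′ a) → (∀ {a} → C′ a → C a) →
                ∀ {a b} → Pick L C a → Pick L C′ b → a ≡ b
  pick-unique to from (m , lm , p) (n , ln , q)
    with refl ← least-unique (λ (b , b∈ , c) → b , b∈ , to c) (λ (b , b∈ , c) → b , b∈ , from c) lm ln
    = first-unique to from p q

-- Adequacy of the three theories.

-- Induction on derivations for any congruence on monomial lists: permutation for `ACU` and `ACUh`,
-- mutual inclusion for `FL₀`.
module Soundness {r : ℕ} {E : Theory (Sig r)} (_≋_ : List (Monomial {r}) → List Monomial → Set)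
  (≋-refl : ∀ {l} → l ≋ l) (≋-sym : ∀ {l l′} → l ≋ l′ → l′ ≋ l)
  (≋-trans : ∀ {l l′ l″} → l ≋ l′ → l′ ≋ l″ → l ≋ l″)
  (++⁺ : ∀ {k k′ l l′} → k ≋ k′ → l ≋ l′ → (k ++ l) ≋ (k′ ++ l′))
  (map⁺ : ∀ i {l l′} → l ≋ l′ → map (i ·_) l ≋ map (i ·_) l′)
  (ax-≋ : ∀ {s t} → E s t → ∀ ρ → mon (s [ ρ ]) ≋ mon (t [ ρ ])) where

  ≈⇒≋ : ∀ {s t} → E ⊢ s ≈ t → mon s ≋ mon t
  ≈⇒≋ (ax e ρ)    = ax-≋ e ρ
  ≈⇒≋ refl        = ≋-refl
  ≈⇒≋ (sym p)     = ≋-sym (≈⇒≋ p)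
  ≈⇒≋ (trans p q) = ≋-trans (≈⇒≋ p) (≈⇒≋ q)
  ≈⇒≋ (cong f {_ ∷ _ ∷ []} {_ ∷ _ ∷ []} (p ∷ q ∷ [])) = ++⁺ (≈⇒≋ p) (≈⇒≋ q)
  ≈⇒≋ (cong 𝟘 {[]} {[]} [])                             = ≋-refl
  ≈⇒≋ (cong (h i) {_ ∷ []} {_ ∷ []} (p ∷ []))          = map⁺ i (≈⇒≋ p)

ACUh-↭ : ∀ {r} {s t : Term (Sig r)} → ACUh-identities s t → ∀ ρ → mon (s [ ρ ]) ↭ mon (t [ ρ ])
ACUh-↭ (acu assoc)  ρ = ↭-sym (Perm.++-assoc (mon (ρ 0)) _ _)
ACUh-↭ (acu comm)   ρ = Perm.++-comm (mon (ρ 0)) _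
ACUh-↭ (acu unit)   ρ = Perm.++-identityʳ _
ACUh-↭ (h-homo i)   ρ = ↭-reflexive (List.map-++ (i ·_) (mon (ρ 0)) _)
ACUh-↭ (h-zero i)   ρ = ↭-refl

module Linear {r : ℕ} {E : Theory (Sig r)}
  (acuh-ax : ∀ {s t} → ACUh-identities s t → ∀ ρ → E ⊢ s [ ρ ] ≈ t [ ρ ])
  (only-acuh : ∀ {s t} → E s t → ACUh-identities s t) where

  open Sums {E = E} acuh-ax
  open Soundness {E = E} _↭_ ↭-refl ↭-sym ↭-trans Perm.++⁺ (λ i → Perm.map⁺ (i ·_))
    (ACUh-↭ ∘ only-acuh)

  adequate : Adequate E
  adequate = record
    { acuh-ax  = acuh-ax
    ; sound    = λ p → Perm.∈-resp-↭ (≈⇒≋ p)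
    ; single   = λ s u t x p x∈s s⊆x x∉t →
        ↭⇒≈ s (var x) (↭-reflexive (single-list x∈s s⊆x x∉t (≈⇒≋ p)))
    ; compress = λ n s t ρ ne p len small →
        mon t , Σ-mon t , small , ℕ.m≤n⇒m≤n+o _ (ℕ.≤-trans (length-mon-[] t ne)
          (ℕ.≤-trans (ℕ.≤-reflexive (Perm.↭-length (≈⇒≋ p))) len))
    }
    where
    -- A second element of `k` would again be `m`, and cancelling one copy of `m` would leave the
    -- other in `l′`.
    single-list : ∀ {m : Monomial {r}} {k l l′} → m ∈ k → k ⊆ m ∷ [] → m ∉ l′ →
                  k ++ l ↭ m ∷ l′ → k ≡ m ∷ []
    single-list {k = _ ∷ _} m∈ k⊆m m∉ p with k⊆m (here refl)
    single-list {k = _ ∷ []} m∈ k⊆m m∉ p | here refl = refl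
    single-list {k = _ ∷ _ ∷ _} m∈ k⊆m m∉ p | here refl with k⊆m (there (here refl))
    ... | here refl = contradiction (Perm.∈-resp-↭ (Perm.drop-∷ p) (here refl)) m∉

ACU-adequate : Adequate ACU
ACU-adequate = Linear.adequate acuh-ax acu
  where
  acuh-ax : ∀ {s t} → ACUh-identities s t → ∀ ρ → ACU ⊢ s [ ρ ] ≈ t [ ρ ]
  -- Without unary symbols the homomorphism identities have no instances.
  acuh-ax (acu e) ρ = ax e ρ

ACUh-adequate : ∀ r → Adequate (ACUh r)
ACUh-adequate r = Linear.adequate ax (λ e → e)

module Idempotent (r : ℕ) where

  open Sums {E = FL₀ r} (ax ∘ acuh)

  _∼_ : List (Monomial {r}) → List Monomial → Set
  k ∼ l = k ⊆ l × l ⊆ k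

  FL₀-∼ : ∀ {s t} → FL₀-identities s t → ∀ ρ → mon (s [ ρ ]) ∼ mon (t [ ρ ])
  FL₀-∼ (acuh e) ρ = Perm.∈-resp-↭ (ACUh-↭ e ρ) , Perm.∈-resp-↭ (↭-sym (ACUh-↭ e ρ))
  FL₀-∼ idem     ρ = (λ m∈ → [ (λ p → p) , (λ p → p) ]′ (∈-++⁻ (mon (ρ 0)) m∈)) , ∈-++⁺ˡ

  open Soundness {E = FL₀ r} _∼_ ((λ p → p) , (λ p → p)) (λ (p , q) → q , p)
    (λ (p , q) (p′ , q′) → (p′ ∘ p) , (q ∘ q′))
    (λ (p , q) (p′ , q′) → Subset.++⁺ p p′ , Subset.++⁺ q q′)
    (λ i (p , q) → Subset.map⁺ (i ·_) p , Subset.map⁺ (i ·_) q) FL₀-∼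

  ⊕-idem : ∀ t → FL₀ r ⊢ t ⊕ t ≈ t
  ⊕-idem t = ax idem (λ _ → t)

  absorb : ∀ {m} l → m ∈ l → FL₀ r ⊢ mono m ⊕ Σ⟦ l ⟧ ≈ Σ⟦ l ⟧
  absorb (m ∷ l) (here refl) = trans (sym (⊕-assoc (mono m) (mono m) Σ⟦ l ⟧)) (⊕-cong (⊕-idem (mono m)) refl)
  absorb {m} (m′ ∷ l) (there m∈) = begin
    mono m ⊕ (mono m′ ⊕ Σ⟦ l ⟧)  ≈⟨ Σ-↭ {m ∷ m′ ∷ l} {m′ ∷ m ∷ l} (swap m m′ ↭-refl) ⟩
    mono m′ ⊕ (mono m ⊕ Σ⟦ l ⟧)  ≈⟨ ⊕-cong refl (absorb l m∈) ⟩
    mono m′ ⊕ Σ⟦ l ⟧             ∎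
    where open SetoidReasoning ≈-setoid

  dedup : ∀ l → ∃[ k ] (FL₀ r ⊢ Σ⟦ l ⟧ ≈ Σ⟦ k ⟧ × Unique k × k ⊆ l)
  dedup []      = [] , refl , [] , λ ()
  dedup (m ∷ l) with k , p , uniq , k⊆l ← dedup l | m ∈ᵐ? k
  ... | yes m∈k = k , trans (⊕-cong refl p) (absorb k m∈k) , uniq , there ∘ k⊆l
  ... | no  m∉k = m ∷ k , ⊕-cong refl p , All.tabulate (λ { m′∈k refl → m∉k m′∈k }) ∷ uniq , λ
    { (here refl) → here refl ; (there m′∈) → there (k⊆l m′∈) }

  collapse : ∀ l x → l ⊆ ([] , x) ∷ [] → FL₀ r ⊢ var x ⊕ Σ⟦ l ⟧ ≈ var x
  collapse []      x l⊆x = ⊕-identityʳ _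
  collapse (m ∷ l) x l⊆x with l⊆x (here refl)
  ... | here refl = trans (⊕-cong refl (collapse l x (l⊆x ∘ there))) (⊕-idem _)

  constant : ∀ l x → ([] , x) ∈ l → l ⊆ ([] , x) ∷ [] → FL₀ r ⊢ Σ⟦ l ⟧ ≈ var x
  constant l x x∈l l⊆x = trans (sym (absorb l x∈l)) (collapse l x l⊆x)

  adequate : Adequate (FL₀ r)
  adequate = record
    { acuh-ax  = ax ∘ acuh
    ; sound    = proj₁ ∘ ≈⇒≋
    ; single   = λ s u t x p x∈s s⊆x x∉t → trans (Σ-mon s) (constant (mon s) x x∈s s⊆x)
    ; compress = λ n s t ρ ne p len small →
        let k , q , uniq , k⊆ = dedup (mon t)
            small′ = All.tabulate (All.lookup small ∘ k⊆)
        in  k , trans (Σ-mon t) q , small′ ,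
            ℕ.m≤n⇒m≤o+n n (unique⊆⇒length≤ uniq (∈-alphabet ∘ All.lookup small′))
    }

-- The instantiation preorder and preimages of variables under witnesses.

module Instantiation {r : ℕ} (em : ExcludedMiddle 0ℓ) {E : Theory (Sig r)}
  (adequate : Adequate E) where

  open Adequate adequate
  open Sums {E = E} acuh-ax

  infix 4 _≲_

  _≲_ : Subst (Sig r) → Subst (Sig r) → Set
  σ ≲ τ = E ⊢ σ ≲ τ

  -- ρ ∶ σ ⟶ τ says that ρ witnesses σ ≲ τ.
  _∶_⟶_ : (V → T) → (V → T) → (V → T) → Set
  ρ ∶ σ ⟶ τ = ∀ x → E ⊢ σ x [ ρ ] ≈ τ x

  []-⟶ : ∀ t {σ τ ρ} → ρ ∶ σ ⟶ τ → E ⊢ t [ σ ] [ ρ ] ≈ t [ τ ]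
  []-⟶ t p = trans (≈-reflexive ([]-∘ t)) ([]-≈ t p)

  ⟶-∘ : ∀ {σ τ υ ρ κ} → ρ ∶ σ ⟶ τ → κ ∶ τ ⟶ υ → (λ z → ρ z [ κ ]) ∶ σ ⟶ υ
  ⟶-∘ {σ} {κ = κ} p q x =
    trans (≈-reflexive (≡.sym ([]-∘ (σ x)))) (trans (≈-[] κ (p x)) (q x))

  ≲-pointwise : ∀ {σ τ} → (∀ x → E ⊢ app σ x ≈ app τ x) → σ ≲ τ
  ≲-pointwise {σ} p = idSubst , λ x → trans (≈-reflexive ([]-var (app σ x))) (p x)

  ≲-refl : ∀ {σ} → σ ≲ σ
  ≲-refl {σ} = ≲-pointwise {σ} {σ} (λ _ → refl)

  ≲-trans : ∀ {σ τ υ} → σ ≲ τ → τ ≲ υ → σ ≲ υ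
  ≲-trans {σ} (ρ , p) (κ , q) = compose em ρ κ , ⟶-∘ {σ = app σ} p q

  Unifier-≲ : ∀ {Γ σ τ} → Unifier E Γ σ → σ ≲ τ → Unifier E Γ τ
  Unifier-≲ u (ρ , p) = All.map
    (λ { {s , t} e → trans (sym ([]-⟶ s p)) (trans (≈-[] (app ρ) e) ([]-⟶ t p)) }) u

  []-≈-on : ∀ t {ρ κ} → (∀ {w x} → (w , x) ∈ mon t → E ⊢ ρ x ≈ κ x) → E ⊢ t [ ρ ] ≈ t [ κ ]
  []-≈-on (var x)             p = p (here refl)
  []-≈-on (op f (s ∷ t ∷ [])) p =
    ⊕-cong ([]-≈-on s (p ∘ ∈-++⁺ˡ)) ([]-≈-on t (p ∘ ∈-++⁺ʳ (mon s)))
  []-≈-on (op 𝟘 [])           p = refl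
  []-≈-on (op (h i) (t ∷ [])) p = H-cong i ([]-≈-on t (p ∘ ∈-map⁺ (i ·_)))

  ≈O : ∀ t → (∀ m → m ∉ mon t) → E ⊢ t ≈ O
  ≈O t none with mon t | Σ-mon t
  ... | []    | p = p
  ... | m ∷ _ | _ = contradiction (here refl) (none m)

  -- Splitting `var z` off `t` exhibits `ρ z` as a summand of `s`.
  factor : ∀ t {s ρ z} → E ⊢ t [ ρ ] ≈ s → ([] , z) ∈ mon t →
           (∃[ u ] E ⊢ ρ z ⊕ u ≈ s) × mon (ρ z) ⊆ mon s
  factor t {ρ = ρ} p z∈ with u , q ← split t z∈ =
    (u [ ρ ] , trans (sym (≈-[] ρ q)) p) , λ m∈ → sound p (mon-[]⁺ t z∈ m∈)

  occurs : ∀ t {s ρ p} → E ⊢ t [ ρ ] ≈ s → ([] , p) ∈ mon s →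
           ∃[ z ] (([] , z) ∈ mon t × ([] , p) ∈ mon (ρ z))
  occurs t e p∈ with mon-[]⁻ t (sound (sym e) p∈)
  ... | [] , [] , z , refl , z∈ , p∈′ = z , z∈ , p∈′

  -- The only monomial of `var p` has the empty word, so `w` is empty and `ρ z` is a summand of
  -- `var p` with `p` as its only monomial; `single` applies.
  factor-var : ∀ t {ρ p w z m} → E ⊢ t [ ρ ] ≈ var p → (w , z) ∈ mon t → m ∈ mon (ρ z) →
               E ⊢ ρ z ≈ var p
  factor-var t e z∈ m∈ with sound e (mon-[]⁺ t z∈ m∈)
  factor-var t {ρ} {p} {[]} {z} {[] , _} e z∈ m∈ | here refl
    with (u , q) , sub ← factor t {ρ = ρ} e z∈ =
    single (ρ z) u O p (trans q (sym (⊕-identityʳ _))) m∈ sub (λ ())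

  preimage : ∀ t {ρ p} → E ⊢ t [ ρ ] ≈ var p → ∃[ z ] (([] , z) ∈ mon t × E ⊢ ρ z ≈ var p)
  preimage t e with z , z∈ , m∈ ← occurs t e (here refl) = z , z∈ , factor-var t e z∈ m∈

  var-injective : ∀ {x y} → E ⊢ var x ≈ var y → x ≡ y
  var-injective p with sound p (here refl)
  ... | here refl = refl

  -- Almost all variables are their own preimages, so the choice of the others can be
  -- corrected to a permutation, one transposition at a time.
  invert : ∀ n (ρ : Subst (Sig r)) → (∀ p → n ≤ p → ∃[ z ] E ⊢ app ρ z ≈ var p) →
           ∃[ π ] (∀ p → n ≤ p → E ⊢ app ρ (Renaming.from π p) ≈ var p)
  invert n ρ pre with N , ρ-id ← idFrom em ρ =
    go N n pre (λ p N+n≤p → ρ-id p (ℕ.m+n≤o⇒m≤o N N+n≤p))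
    where
    go : ∀ d n → (∀ p → n ≤ p → ∃[ z ] E ⊢ app ρ z ≈ var p) → IdFrom (d + n) (app ρ) →
         ∃[ π ] (∀ p → n ≤ p → E ⊢ app ρ (Renaming.from π p) ≈ var p)
    go zero    n pre ρ-id = identity , λ p n≤p → ≈-reflexive (ρ-id p n≤p)
    go (suc d) n pre ρ-id
      with π , inv ← go d (suc n) (λ p n<p → pre p (ℕ.<⇒≤ n<p))
             (λ p d+1+n≤p → ρ-id p (ℕ.≤-trans (ℕ.≤-reflexive (≡.sym (ℕ.+-suc d n))) d+1+n≤p))
      with z , ρz≈n ← pre n ℕ.≤-refl = transposeAfter (to z) n π , inv′
      where
      open Renaming π
      -- The transposition must not move variables already inverted: if `to z` were above `n`, then
      -- `ρ z` would be both `to z` and `n`.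
      toz≤n : ¬ suc n ≤ to z
      toz≤n n<toz = ℕ.<⇒≢ n<toz (var-injective (trans (sym ρz≈n)
        (trans (≈-reflexive (≡.cong (app ρ) (≡.sym (from-to z)))) (inv (to z) n<toz))))
      inv′ : ∀ p → n ≤ p → E ⊢ app ρ (from (transpose (to z) n p)) ≈ var p
      inv′ p n≤p with n ℕ.≟ p
      ... | yes refl = trans
        (≈-reflexive (≡.cong (app ρ)
          (≡.trans (≡.cong from (transpose-right (to z) n)) (from-to z)))) ρz≈n
      ... | no n≢p = trans
        (≈-reflexive (≡.cong (app ρ ∘ from) (transpose-fixed
          (λ { refl → toz≤n n<p }) (n≢p ∘ ≡.sym)))) (inv p n<p)
        where n<p = ℕ.≤∧≢⇒< n≤p n≢p

  -- Enumeration of substitutions up to equivalence.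

  Within : ℕ → Pred (T {r}) 0ℓ
  Within n t = All (Small n) (mon t) × length (mon t) ≤ n

  Small-mono : ∀ {m n} → m ≤ n → ∀ {k : Monomial {r}} → Small m k → Small n k
  Small-mono m≤n (len , x<m) = ℕ.≤-trans len m≤n , ℕ.<-≤-trans x<m m≤n

  AllSmall-mono : ∀ {m n} → m ≤ n → ∀ {l : List (Monomial {r})} → All (Small m) l → All (Small n) l
  AllSmall-mono m≤n = All.map (λ {k} → Small-mono m≤n {k})

  Within-mono : ∀ {m n t} → m ≤ n → Within m t → Within n t
  Within-mono m≤n (small , len) = AllSmall-mono m≤n small , ℕ.≤-trans len m≤n

  smallList : ∀ (l : List (Monomial {r})) → ∃[ n ] All (Small n) l
  smallList []            = 0 , []
  smallList ((w , x) ∷ l) with n , small ← smallList l =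
    length w ⊔ suc x ⊔ n
    , ( ℕ.≤-trans (ℕ.m≤m⊔n (length w) (suc x)) (ℕ.m≤m⊔n _ n)
      , ℕ.≤-trans (ℕ.m≤n⊔m (length w) (suc x)) (ℕ.m≤m⊔n _ n))
    ∷ AllSmall-mono (ℕ.m≤n⊔m _ n) small

  within : ∀ t → ∃[ n ] Within n t
  within t with n , small ← smallList (mon t) =
    n ⊔ length (mon t) , AllSmall-mono (ℕ.m≤m⊔n n _) small , ℕ.m≤n⊔m n _

  -- One number bounds the domain, the variables, the word lengths and the numbers of monomials,
  -- which leaves finitely many substitutions up to `≈`.
  Fits : ℕ → Pred (V → T {r}) 0ℓ
  Fits n σ = IdFrom n σ × (∀ x → x < n → Within n (σ x))

  Within-var : ∀ {n x} → x < n → Within n (var x)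
  Within-var x<n = (z≤n , x<n) ∷ [] , ℕ.≤-trans (s≤s z≤n) x<n

  withinBelow : ∀ (σ : V → T {r}) k → ∃[ n ] (∀ x → x < k → Within n (σ x))
  withinBelow σ zero    = 0 , λ _ ()
  withinBelow σ (suc k) with m , below ← withinBelow σ k | n , last ← within (σ k) =
    m ⊔ n , both
    where
    both : ∀ x → x < suc k → Within (m ⊔ n) (σ x)
    both x x≤k with x ℕ.≟ k
    ... | yes refl = Within-mono {t = σ k} (ℕ.m≤n⊔m m n) last
    ... | no  x≢k  = Within-mono {t = σ x} (ℕ.m≤m⊔n m n)
                       (below x (ℕ.≤∧≢⇒< (ℕ.≤-pred x≤k) x≢k))

  fits : ∀ (σ : Subst (Sig r)) → ∃[ n ] Fits n (app σ)
  fits σ with m , σ-id ← idFrom em σ with n , below ← withinBelow (app σ) m =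
    m ⊔ n , (λ x p → σ-id x (ℕ.m⊔n≤o⇒m≤o m n p)) , bounded
    where
    bounded : ∀ x → x < m ⊔ n → Within (m ⊔ n) (app σ x)
    bounded x x< with x ℕ.<? m
    ... | yes x<m = Within-mono {t = app σ x} (ℕ.m≤n⊔m m n) (below x x<m)
    ... | no  x≮m = ≡.subst (Within (m ⊔ n)) (≡.sym (σ-id x (ℕ.≮⇒≥ x≮m))) (Within-var x<)

  terms : ℕ → List (T {r})
  terms n = map Σ⟦_⟧ (tuples (alphabet n) n)

  listSubst : List T → Subst (Sig r)
  listSubst ts = subst {n = length ts} (override ts var) (λ x → override-≥ ts x)

  substs : ℕ → List (Subst (Sig r))
  substs n = map listSubst (tuples (terms n) n)

  -- The tail `ρ` is arbitrary so that the induction can shift all variables by one.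
  overrides : ∀ {C : List T} k (σ ρ : V → T) →
              (∀ x → x < k → ∃[ t ] (t ∈ C × E ⊢ t ≈ σ x)) → (∀ x → k ≤ x → σ x ≡ ρ x) →
              ∃[ ts ] (All (_∈ C) ts × length ts ≡ k × (∀ x → E ⊢ override ts ρ x ≈ σ x))
  overrides zero    σ ρ pre σ≡ρ = [] , [] , refl , λ x → ≈-reflexive (≡.sym (σ≡ρ x z≤n))
  overrides (suc k) σ ρ pre σ≡ρ
    with t , t∈ , t≈ ← pre 0 (s≤s z≤n)
       | ts , ts∈ , len , ts≈ ← overrides k (σ ∘ suc) (ρ ∘ suc)
           (λ x → pre (suc x) ∘ s≤s) (λ x → σ≡ρ (suc x) ∘ s≤s) =
    t ∷ ts , t∈ ∷ ts∈ , ≡.cong suc len , λ { zero → t≈ ; (suc x) → ts≈ x }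

  enumerated : ∀ {n σ} → IdFrom n σ →
               (∀ x → x < n → ∃[ l ] (E ⊢ σ x ≈ Σ⟦ l ⟧ × All (Small n) l × length l ≤ n)) →
               ∃[ β ] (β ∈ substs n × (∀ x → E ⊢ app β x ≈ σ x))
  enumerated {n} {σ} σ-id sums
    with ts , ts∈ , len , ts≈ ← overrides n σ var
           (λ x x<n → let l , p , small , len = sums x x<n in
             Σ⟦ l ⟧ , ∈-map⁺ Σ⟦_⟧ (∈-tuples l (All.map ∈-alphabet small) len) , sym p) σ-id =
    listSubst ts , ∈-map⁺ listSubst (∈-tuples ts ts∈ (ℕ.≤-reflexive len)) , ts≈

  representative : ∀ σ → ∃[ n ] ∃[ β ] (β ∈ substs n × β ≲ σ × σ ≲ β)
  representative σ with n , σ-id , small ← fits σ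
    with β , β∈ , β≈ ← enumerated σ-id (λ x x<n → mon (app σ x) , Σ-mon (app σ x) , small x x<n) =
    n , β , β∈ , ≲-pointwise {β} {σ} β≈ , ≲-pointwise {σ} {β} (sym ∘ β≈)

  -- Finitely many unifiers reach a given one without erasing.

  below : ℕ → (V → T {r}) → (V → T) → V → T
  below n σ τ x with x ℕ.<? n
  ... | yes _ = σ x
  ... | no  _ = τ x

  below-< : ∀ {n σ τ x} → x < n → below n σ τ x ≡ σ x
  below-< {n} {x = x} x<n with x ℕ.<? n
  ... | yes _ = refl
  ... | no  p = contradiction x<n p

  below-≥ : ∀ {n σ τ x} → n ≤ x → below n σ τ x ≡ τ x
  below-≥ {n} {x = x} n≤x with x ℕ.<? n
  ... | yes p = contradiction n≤x (ℕ.<⇒≱ p)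
  ... | no  _ = refl

  capacity≥ : ∀ n → n ≤ capacity r n
  capacity≥ n = ℕ.m≤m+n n _

  -- Once ρ fixes the variables from n on, α is equivalent to its truncation at n: no variable
  -- of a term α x with x < n occurs in a term α y with y ≥ n, because ρ maps the former into
  -- the variables below n and the latter to y.
  module Truncation {n : ℕ} {σ α ρ : Subst (Sig r)} (fit : Fits n (app σ))
    (ne : NonErasing (app ρ)) (ρ∶ : app ρ ∶ app α ⟶ app σ)
    (fixed : ∀ p → n ≤ p → E ⊢ app ρ p ≈ var p) where

    -- By non-erasure each `w` is a prefix of a word in `σ x`, which bounds its length. A variable
    -- `z ≥ n` is fixed by `ρ` and would occur in `σ x`.
    small : ∀ {x} → x < n → All (Small n) (mon (app α x))
    small {x} x<n = All.tabulate λ { {w , z} m∈ → smallWord m∈ , smallVar m∈ }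
      where
      image : ∀ {w z w′ y} → (w , z) ∈ mon (app α x) → (w′ , y) ∈ mon (app ρ z) →
              Small n (w ++ w′ , y)
      image m∈ m′∈ = All.lookup (proj₁ (proj₂ fit x x<n)) (sound (ρ∶ x) (mon-[]⁺ (app α x) m∈ m′∈))
      smallWord : ∀ {w z} → (w , z) ∈ mon (app α x) → length w ≤ n
      smallWord {w} {z} m∈ with y , w′ , m′∈ ← ne z = ℕ.≤-trans
        (ℕ.≤-trans (ℕ.m≤m+n _ (length w′)) (ℕ.≤-reflexive (≡.sym (List.length-++ w))))
        (proj₁ (image m∈ m′∈))
      smallVar : ∀ {w z} → (w , z) ∈ mon (app α x) → z < n
      smallVar {z = z} m∈ = ℕ.≰⇒> λ n≤z →
        ℕ.<⇒≱ (proj₂ (image m∈ (sound (sym (fixed z n≤z)) (here refl)))) n≤z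

    below-n : ∀ {x w z} → x < n → (w , z) ∈ mon (app α x) → z < n
    below-n x<n m∈ = proj₂ (All.lookup (small x<n) m∈)

    truncated : Subst (Sig r)
    truncated = subst {n = n} (below n (app α) var) (λ x → below-≥)

    truncated-enumerated : ∃[ β ] (β ∈ substs (capacity r n) × (∀ x → E ⊢ app β x ≈ app truncated x))
    truncated-enumerated = enumerated {capacity r n}
      (λ x p → below-≥ (ℕ.≤-trans (capacity≥ n) p)) sums
      where
      sums : ∀ x → x < capacity r n → ∃[ l ] (E ⊢ app truncated x ≈ Σ⟦ l ⟧ ×
               All (Small (capacity r n)) l × length l ≤ capacity r n)
      sums x x< with x ℕ.<? n
      ... | yes x<n =
        let l , p , l-small , len =
              compress n (app σ x) (app α x) (app ρ) ne (ρ∶ x) (proj₂ (proj₂ fit x x<n)) (small x<n)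
        in  l , p , AllSmall-mono (capacity≥ n) l-small , len
      ... | no  x≮n = mon (var x) , Σ-mon (var x) , Within-var x<

    -- The terms at `x < n` contain only variables below `n`. The witness keeps these and is free to
    -- act as `α` from `n` on.
    truncated≲α : truncated ≲ α
    truncated≲α with k , α-id ← idFrom em α =
      subst {n = k} κ (λ x k≤x → κ-id x (α-id x k≤x)) , κ∶
      where
      κ : V → T
      κ = below n var (app α)
      κ-id : ∀ x → app α x ≡ var x → κ x ≡ var x
      κ-id x p with x ℕ.<? n
      ... | yes _ = refl
      ... | no  _ = p
      κ∶ : κ ∶ app truncated ⟶ app α
      κ∶ x with x ℕ.<? n
      ... | yes x<n = trans
        ([]-≈-on (app α x) (λ m∈ → ≈-reflexive (below-< (below-n x<n m∈))))
        (≈-reflexive ([]-var (app α x)))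
      ... | no  x≮n = ≈-reflexive (below-≥ (ℕ.≮⇒≥ x≮n))

    α≲truncated : α ≲ truncated
    α≲truncated with k , ρ-id ← idFrom em ρ =
      subst {n = k} θ (λ x k≤x → θ-id x (ρ-id x k≤x)) , θ∶
      where
      -- All variables in terms `α x` with `x ≥ n` escape, and none in terms with `x < n` do; so `θ`
      -- can apply `ρ` to the former and keep the latter.
      Escapes : V → Set
      Escapes z = ∃[ p ] (n ≤ p × E ⊢ app ρ z ≈ var p)
      θ : V → T
      θ z with em {Escapes z}
      ... | yes _ = app ρ z
      ... | no  _ = var z
      θ-id : ∀ z → app ρ z ≡ var z → θ z ≡ var z
      θ-id z p with em {Escapes z}
      ... | yes _ = p
      ... | no  _ = refl
      θ-escapes : ∀ {z} → Escapes z → θ z ≡ app ρ z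
      θ-escapes {z} esc with em {Escapes z}
      ... | yes _ = refl
      ... | no  p = contradiction esc p
      θ-stays : ∀ {z} → ¬ Escapes z → θ z ≡ var z
      θ-stays {z} stays with em {Escapes z}
      ... | yes p = contradiction p stays
      ... | no  _ = refl
      stays : ∀ {x w z} → x < n → (w , z) ∈ mon (app α x) → ¬ Escapes z
      stays {x} x<n m∈ (p , n≤p , ρz≈p) = ℕ.<⇒≱
        (proj₂ (All.lookup (proj₁ (proj₂ fit x x<n))
          (sound (ρ∶ x) (mon-[]⁺ (app α x) m∈ (sound (sym ρz≈p) (here refl)))))) n≤p
      escapes : ∀ {x w z} → n ≤ x → (w , z) ∈ mon (app α x) → Escapes z
      escapes {x} {z = z} n≤x m∈ = x , n≤x , factor-var (app α x)
        (trans (ρ∶ x) (≈-reflexive (proj₁ fit x n≤x))) m∈ (proj₂ (proj₂ (ne z)))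
      θ∶ : θ ∶ app α ⟶ app truncated
      θ∶ x with x ℕ.<? n
      ... | yes x<n = trans
        ([]-≈-on (app α x) (λ m∈ → ≈-reflexive (θ-stays (stays x<n m∈))))
        (≈-reflexive ([]-var (app α x)))
      ... | no  x≮n = trans
        ([]-≈-on (app α x) (λ m∈ → ≈-reflexive (θ-escapes (escapes (ℕ.≮⇒≥ x≮n) m∈))))
        (trans (ρ∶ x) (≈-reflexive (proj₁ fit x (ℕ.≮⇒≥ x≮n))))

  preimages : ∀ {n} {σ α ρ : V → T} → IdFrom n σ → ρ ∶ α ⟶ σ →
              ∀ p → n ≤ p → ∃[ z ] E ⊢ ρ z ≈ var p
  preimages {α = α} σ-id ρ∶ p n≤p
    with z , _ , ρz≈p ← preimage (α p) (trans (ρ∶ p) (≈-reflexive (σ-id p n≤p))) = z , ρz≈p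

  -- Composing `α` with the permutation from `invert` gives an equivalent substitution whose witness
  -- fixes the variables from `n` on, so that truncation applies.
  nonErasing⇒enumerated : ∀ {n} {σ α ρ : Subst (Sig r)} → Fits n (app σ) → NonErasing (app ρ) →
    app ρ ∶ app α ⟶ app σ → ∃[ β ] (β ∈ substs (capacity r n) × α ≲ β × β ≲ α)
  nonErasing⇒enumerated {n} {σ} {α} {ρ} fit ne ρ∶
    with π , inv ← invert n ρ (preimages {α = app α} (proj₁ fit) ρ∶)
    = result
    where
    open Renaming π
    α₁ ρ₁ : Subst (Sig r)
    α₁ = compose em α toˢ
    ρ₁ = compose em fromˢ ρ
    ρ₁∶ : app ρ₁ ∶ app α₁ ⟶ app σ
    ρ₁∶ x = trans
      (trans (≈-reflexive ([]-∘ (app α x))) ([]-≈ (app α x) (λ z → ≈-reflexive (≡.cong (app ρ) (from-to z)))))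
      (ρ∶ x)
    α≲α₁ : α ≲ α₁
    α≲α₁ = toˢ , λ _ → refl
    α₁≲α : α₁ ≲ α
    α₁≲α = fromˢ , λ x → trans
      (trans (≈-reflexive ([]-∘ (app α x))) ([]-≈ (app α x) (λ z → ≈-reflexive (≡.cong var (from-to z)))))
      (≈-reflexive ([]-var (app α x)))
    module Tr = Truncation {n} {σ} {α₁} {ρ₁} fit (λ z → ne (from z)) ρ₁∶ inv
    result : ∃[ β ] (β ∈ substs (capacity r n) × α ≲ β × β ≲ α)
    result with β , β∈ , β≈ ← Tr.truncated-enumerated =
      β , β∈ ,
      ≲-trans {α} {α₁} {β} α≲α₁ (≲-trans {α₁} {Tr.truncated} {β} Tr.α≲truncated
        (≲-pointwise {Tr.truncated} {β} (sym ∘ β≈))) ,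
      ≲-trans {β} {α₁} {α} (≲-trans {β} {Tr.truncated} {α₁}
        (≲-pointwise {β} {Tr.truncated} β≈) Tr.truncated≲α) α₁≲α

  -- Erasable variables and the existence of minimal complete sets.

  Erases : (V → T {r}) → Pred V 0ℓ
  Erases ρ z = ∀ m → m ∉ mon (ρ z)

  ¬erases⇒occurs : ∀ {ρ : V → T} {z} → ¬ Erases ρ z → ∃[ y ] y ∈ᵛ ρ z
  ¬erases⇒occurs {ρ} {z} ¬e = decidable-stable em
    (λ none → ¬e (λ { (w , y) m∈ → none (y , w , m∈) }))

  module Minimality (Γ : Problem (Sig r)) where

    MinimalUnifier : Pred (Subst (Sig r)) 0ℓ
    MinimalUnifier σ = Unifier E Γ σ × (∀ τ → Unifier E Γ τ → τ ≲ σ → σ ≲ τ)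

    -- The inequality is strict so that no unifier satisfies `Bounded zero`: the identity witness
    -- with the empty list refutes it. This is the base of the induction in `minimalBelow`.
    Bounded : ℕ → Pred (Subst (Sig r)) 0ℓ
    Bounded e σ = ∀ σ′ (ρ : Subst (Sig r)) l → Unifier E Γ σ′ → app ρ ∶ app σ′ ⟶ app σ →
                  Unique l → All (Erases (app ρ)) l → length l < e

    -- If `to z ≥ n`, then `ρ z` is equivalent to a variable and `z` is not erased. Hence `to` maps
    -- the erased variables injectively into those below `n`.
    IdFrom⇒Bounded : ∀ {n} σ → IdFrom n (app σ) → Bounded (suc n) σ
    IdFrom⇒Bounded {n} σ σ-id σ′ ρ l _ ρ∶ uniq erased
      with π , inv ← invert n ρ (preimages {α = app σ′} σ-id ρ∶) = s≤s (begin
        length l                 ≡⟨ List.length-map to l ⟨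
        length (map to l)        ≤⟨ unique⊆⇒length≤ (Unique.map⁺ to-injective uniq) sub ⟩
        length (upTo n)          ≡⟨ List.length-upTo n ⟩
        n                        ∎)
      where
      open ℕ.≤-Reasoning
      open Renaming π
      to-injective : ∀ {x y} → to x ≡ to y → x ≡ y
      to-injective {x} {y} p = ≡.trans (≡.sym (from-to x)) (≡.trans (≡.cong from p) (from-to y))
      sub : map to l ⊆ upTo n
      sub x∈ with z , z∈ , refl ← ∈-map⁻ to x∈ = ∈-upTo⁺ (ℕ.≰⇒> λ n≤toz →
        All.lookup erased z∈ _ (≡.subst (λ y → ([] , to z) ∈ mon (app ρ y)) (from-to z)
          (sound (sym (inv (to z) n≤toz)) (here refl))))

    Refinement : Subst (Sig r) → Pred (Subst (Sig r)) 0ℓ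
    Refinement σ α = Unifier E Γ α × ∃[ ρ ] (NonErasing (app ρ) × app ρ ∶ app α ⟶ app σ)

    ¬Bounded⇒ : ∀ {e σ} → ¬ Bounded e σ → ∃[ σ′ ] ∃[ ρ ] ∃[ l ] (Unifier E Γ σ′ ×
                app ρ ∶ app σ′ ⟶ app σ × Unique l × All (Erases (app ρ)) l × e ≤ length l)
    ¬Bounded⇒ ¬b = decidable-stable em (λ none → ¬b (λ σ′ ρ l u ρ∶ uniq erased →
      ℕ.≰⇒> (λ e≤ → none (σ′ , ρ , l , u , ρ∶ , uniq , erased , e≤))))

    on : List V → (V → T {r}) → (V → T) → V → T
    on l σ τ z with any? (z ℕ.≟_) l
    ... | yes _ = σ z
    ... | no  _ = τ z

    on-∉ : ∀ {l σ τ z} → z ∉ l → on l σ τ z ≡ τ z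
    on-∉ {l} {z = z} z∉ with any? (z ℕ.≟_) l
    ... | yes z∈ = contradiction z∈ z∉
    ... | no  _  = refl

    -- Let ρ : σ₂ → σ₁ erase as many variables as any witness into σ can. Then a witness
    -- of σ₁ ≲ σ causes no further erasure, and α is σ₂ with the erased variables deleted.
    module Saturated {e : ℕ} {σ σ₁ σ₂ ρ κ : Subst (Sig r)} {l : List V}
      (bounded : Bounded (suc e) σ) (u : Unifier E Γ σ₂)
      (ρ∶ : app ρ ∶ app σ₂ ⟶ app σ₁) (κ∶ : app κ ∶ app σ₁ ⟶ app σ)
      (uniq : Unique l) (erased : All (Erases (app ρ)) l) (e≤ : e ≤ length l) where

      δ α μ μ′ : Subst (Sig r)
      δ  = subst {n = proj₁ (bound l)} (on l (λ _ → O) var)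
             (λ z p → on-∉ (λ z∈ → ℕ.<⇒≱ (proj₂ (bound l) z∈) p))
      α  = compose em σ₂ δ
      μ  = compose em ρ κ
      -- `δ` has removed the variables of `l` from `α`, so `μ′` may keep them instead of erasing
      -- them.
      μ′ = subst {n = proj₁ (idFrom em μ)} (on l var (app μ)) (λ z p → id′ z (proj₂ (idFrom em μ) z p))
        where
        id′ : ∀ z → app μ z ≡ var z → on l var (app μ) z ≡ var z
        id′ z p with any? (z ℕ.≟_) l
        ... | yes _ = refl
        ... | no  _ = p

      μ∶ : app μ ∶ app σ₂ ⟶ app σ
      μ∶ = ⟶-∘ {σ = app σ₂} {κ = app κ} ρ∶ κ∶

      μ-erased : All (Erases (app μ)) l
      μ-erased = All.map (λ {z} ez (w , y) m∈ →
        let _ , _ , _ , _ , m′∈ , _ = mon-[]⁻ (app ρ z) m∈ in ez _ m′∈) erased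

      α≲σ₁ : α ≲ σ₁
      α≲σ₁ = ρ , λ x → trans (≈-reflexive ([]-∘ (app σ₂ x))) (trans ([]-≈ (app σ₂ x) δρ) (ρ∶ x))
        where
        δρ : ∀ z → E ⊢ app δ z [ app ρ ] ≈ app ρ z
        δρ z with any? (z ℕ.≟_) l
        ... | yes z∈ = sym (≈O (app ρ z) (All.lookup erased z∈))
        ... | no  _  = refl

      μ′∶ : app μ′ ∶ app α ⟶ app σ
      μ′∶ x = trans (≈-reflexive ([]-∘ (app σ₂ x))) (trans ([]-≈ (app σ₂ x) δμ′) (μ∶ x))
        where
        δμ′ : ∀ z → E ⊢ app δ z [ app μ′ ] ≈ app μ z
        δμ′ z with any? (z ℕ.≟_) l
        ... | yes z∈ = sym (≈O (app μ z) (All.lookup μ-erased z∈))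
        ... | no  z∉ = ≈-reflexive (on-∉ z∉)

      -- Another variable erased by `μ` would, together with `l`, exceed the bound `e` on erasures
      -- into `σ`.
      μ′-nonErasing : NonErasing (app μ′)
      μ′-nonErasing z with any? (z ℕ.≟_) l
      ... | yes _  = z , [] , here refl
      ... | no  z∉ = ¬erases⇒occurs {app μ} λ ez → ℕ.<⇒≱
        (ℕ.≤-pred (bounded σ₂ μ (z ∷ l) u μ∶ (All.tabulate (λ { y∈ refl → z∉ y∈ }) ∷ uniq) (ez ∷ μ-erased)))
        e≤

      refinement : Refinement σ α
      refinement = Unifier-≲ {σ = σ₂} {τ = α} u (δ , λ _ → refl) , μ′ , μ′-nonErasing , μ′∶

    Least-refinement : Subst (Sig r) → Pred (Subst (Sig r)) 0ℓ
    Least-refinement σ α = Refinement σ α × (∀ {β} → Refinement σ β → β ≲ α → α ≲ β)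

    least-refinement : ∀ σ → ∃ (Refinement σ) → ∃ (Least-refinement σ)
    least-refinement σ ref with n , fit ← fits σ =
      finite⇒minimal em {_≲_} (λ {τ} → ≲-refl {τ}) (λ {τ} {υ} {φ} → ≲-trans {τ} {υ} {φ})
        (substs (capacity r n)) (Refinement σ)
        (λ { {β} (_ , ρ , ne , ρ∶) → nonErasing⇒enumerated {σ = σ} {α = β} {ρ = ρ} fit ne ρ∶ }) ref

    Refines-below : Pred (Subst (Sig r)) 0ℓ
    Refines-below σ = ∀ τ → Unifier E Γ τ → τ ≲ σ → ∃[ α ] (Refinement σ α × α ≲ τ)

    -- A unifier `τ` below `α` is also below `σ`, so some refinement `β` lies below `τ`; leastness
    -- of `α` among refinements gives `α ≲ β ≲ τ`.
    least⇒minimal : ∀ {σ α} → Refines-below σ → Least-refinement σ α → MinimalUnifier α × α ≲ σ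
    least⇒minimal {σ} {α} refine ((u , ρ , _ , ρ∶) , least-α) = (u , minimal) , ρ , ρ∶
      where
      minimal : ∀ τ → Unifier E Γ τ → τ ≲ α → α ≲ τ
      minimal τ uτ τ≲α with β , refβ , β≲τ ← refine τ uτ (≲-trans {τ} {α} {σ} τ≲α (ρ , ρ∶)) =
        ≲-trans {α} {β} {τ} (least-α {β} refβ (≲-trans {β} {τ} {α} β≲τ τ≲α)) β≲τ

    saturated⇒refines : ∀ {e σ} → Bounded (suc e) σ →
      ¬ (∃[ σ₁ ] (Unifier E Γ σ₁ × σ₁ ≲ σ × Bounded e σ₁)) → Refines-below σ
    saturated⇒refines {e} {σ} b none σ₁ u₁ (κ , κ∶)
      with σ₂ , ρ , l , u₂ , ρ∶ , uniq , erased , e≤ ← ¬Bounded⇒ {e} {σ₁} (λ b₁ → none (σ₁ , u₁ , (κ , κ∶) , b₁)) =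
      S.α , S.refinement , S.α≲σ₁
      where module S = Saturated {e} {σ} {σ₁} {σ₂} {ρ} {κ} b u₂ ρ∶ κ∶ uniq erased e≤

    -- Induction on the bound: pass to a unifier below `σ` with a smaller bound if there is one.
    -- Otherwise `σ` is saturated, and a minimal refinement of it is a minimal unifier.
    minimalBelow : ∀ e σ → Unifier E Γ σ → Bounded e σ → ∃[ α ] (MinimalUnifier α × α ≲ σ)
    minimalBelow zero σ u b =
      contradiction (b σ idSubst [] u (λ x → ≈-reflexive ([]-var (app σ x))) [] []) λ ()
    minimalBelow (suc e) σ u b
      with em {∃[ σ₁ ] (Unifier E Γ σ₁ × σ₁ ≲ σ × Bounded e σ₁)}
    ... | yes (σ₁ , u₁ , σ₁≲σ , b₁) with α , min , α≲σ₁ ← minimalBelow e σ₁ u₁ b₁ =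
      α , min , ≲-trans {α} {σ₁} {σ} α≲σ₁ σ₁≲σ
    ... | no none
      with refine ← saturated⇒refines {e} {σ} b none
      with β , refβ , _ ← refine σ u (≲-refl {σ})
      with α , least-α ← least-refinement σ (β , refβ) = α , least⇒minimal {σ} {α} refine least-α

    Equivalent : Subst (Sig r) → Pred (Subst (Sig r)) 0ℓ
    Equivalent σ τ = σ ≲ τ × τ ≲ σ

    -- One minimal unifier per equivalence class. Any member `α` may name the class, since the pick
    -- depends only on its extension.
    Representatives : Pred (Subst (Sig r)) 0ℓ
    Representatives σ = MinimalUnifier σ × ∃[ α ] (Equivalent α σ × Pick substs (Equivalent α) σ)

    representatives-minimalComplete : MinimalCompleteSet E Γ Representatives
    representatives-minimalComplete = (proj₁ ∘ proj₁) , complete , minimal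
      where
      transport : ∀ {σ τ} → Equivalent σ τ → ∀ {υ} → Equivalent σ υ → Equivalent τ υ
      transport {σ} {τ} (σ≲τ , τ≲σ) {υ} (σ≲υ , υ≲σ) =
        ≲-trans {τ} {σ} {υ} τ≲σ σ≲υ , ≲-trans {υ} {σ} {τ} υ≲σ σ≲τ
      complete : Complete E Γ Representatives
      complete θ uθ
        with n , fit ← fits θ
        with α , (uα , minα) , α≲θ ← minimalBelow (suc n) θ uθ (IdFrom⇒Bounded θ (proj₁ fit))
        with m , β , β∈ , β≲α , α≲β ← representative α
        with γ , picked , (α≲γ , γ≲α) ← pick em {substs} {Equivalent α} m β∈ (α≲β , β≲α) =
        γ , ((Unifier-≲ {σ = α} {τ = γ} uα α≲γ ,
              λ τ uτ τ≲γ → ≲-trans {γ} {α} {τ} γ≲α (minα τ uτ (≲-trans {τ} {γ} {α} τ≲γ γ≲α)))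
            , α , (α≲γ , γ≲α) , picked) , ≲-trans {γ} {α} {θ} γ≲α α≲θ
      minimal : Minimal E Γ Representatives
      minimal {σ} {τ} (minσ , α , (α≲σ , σ≲α) , pickσ) (minτ , β , (β≲τ , τ≲β) , pickτ) σ≉τ σ≲τ =
        σ≉τ λ x → ≡.cong (λ υ → app υ x)
          (pick-unique (λ {υ} → transport {α} {β} (α≲β , β≲α) {υ})
            (λ {υ} → transport {β} {α} (β≲α , α≲β) {υ}) pickσ pickτ)
        where
        τ≲σ : τ ≲ σ
        τ≲σ = proj₂ minτ σ (proj₁ minσ) σ≲τ
        α≲β : α ≲ β
        α≲β = ≲-trans {α} {σ} {β} α≲σ (≲-trans {σ} {τ} {β} σ≲τ τ≲β)
        β≲α : β ≲ α
        β≲α = ≲-trans {β} {τ} {α} β≲τ (≲-trans {τ} {σ} {α} τ≲σ σ≲α)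

  -- A problem with infinitely many incomparable minimal unifiers.

  -- The general ACU-solution of x₀ + x₁ ≈ x₂ + x₃ + x₄ has six parameters: x₀ ↦ a + b + c,
  -- x₁ ↦ d + e + y, x₂ ↦ a + d, x₃ ↦ b + e, x₄ ↦ c + y. The five variables of the problem
  -- can serve as a, …, e, but y must then be a variable outside the problem, which is fixed.
  excess : Problem (Sig r)
  excess = (var 0 ⊕ var 1 , var 2 ⊕ (var 3 ⊕ var 4)) ∷ []

  solution : ℕ → Subst (Sig r)
  solution k = listSubst
    ( var 0 ⊕ (var 1 ⊕ var 2) ∷ var 3 ⊕ (var 4 ⊕ var (5 + k))
    ∷ var 0 ⊕ var 3 ∷ var 1 ⊕ var 4 ∷ var 2 ⊕ var (5 + k) ∷ [] )

  solution-unifies : ∀ k → Unifier E excess (solution k)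
  solution-unifies k = ↭⇒≈ _ _
    (prep _ (↭-trans (prep _ (swap _ _ ↭-refl)) (↭-trans (swap _ _ ↭-refl)
      (prep _ (prep _ (swap _ _ ↭-refl)))))) ∷ []

  -- Both solutions fix `5 + i`, hence so does `ρ`; so `5 + i` occurs in the image of x₄ under
  -- `solution j`, whose variables are `2` and `5 + j`.
  solution-injective : ∀ {i j} → solution i ≲ solution j → i ≡ j
  solution-injective {i} {j} (ρ , ρ∶)
    with sound (ρ∶ 4) (∈-++⁺ʳ (mon (app ρ 2)) (sound (sym (ρ∶ (5 + i))) (here refl)))
  ... | there (here refl) = refl

  -- The six parameters form a table with rows x₀, x₁ and columns x₂, x₃, x₄; each is the only one
  -- shared by its row and column.
  module Cells (k : ℕ) {σ ρ : Subst (Sig r)} (u : Unifier E excess σ)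
    (ρ∶ : app ρ ∶ app σ ⟶ app (solution k)) where

    right : List V
    right = 2 ∷ 3 ∷ 4 ∷ []

    σ-covered : ∀ {m} → m ∈ mon (app σ 0) ++ mon (app σ 1) → ∃[ q ] (q ∈ right × m ∈ mon (app σ q))
    σ-covered m∈ with ∈-++⁻ (mon (app σ 2)) (sound (All.head u) m∈)
    ... | inj₁ m∈₂ = 2 , here refl , m∈₂
    ... | inj₂ m∈₃₄ with ∈-++⁻ (mon (app σ 3)) m∈₃₄
    ...   | inj₁ m∈₃ = 3 , there (here refl) , m∈₃
    ...   | inj₂ m∈₄ = 4 , there (there (here refl)) , m∈₄

    private
      τ = app (solution k)

    -- Some `z` in `σ i` produces `p`. As `σ` is a unifier, `z` occurs in some column, which must be
    -- `j`. So `ρ z` has its monomials in both row `i` and column `j`, which leaves only `p`.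
    cell : ∀ i j p t → mon (app σ i) ⊆ mon (app σ 0) ++ mon (app σ 1) →
           ([] , p) ∈ mon (τ i) → E ⊢ τ j ≈ var p ⊕ t → ([] , p) ∉ mon t →
           All (λ m → m ∈ mon (τ j) → m ∈ ([] , p) ∷ []) (mon (τ i)) →
           All (λ q → ([] , p) ∈ mon (τ q) → q ≡ j) right →
           ∃[ z ] E ⊢ app ρ z ≈ var p
    cell i j p t σi⊆ p∈i e p∉t common only-j
      with z , z∈ , p∈ ← occurs (app σ i) (ρ∶ i) p∈i
      with q , q∈ , z∈q ← σ-covered (σi⊆ z∈)
      with v , sub ← factor (app σ q) (ρ∶ q) z∈q
      with refl ← All.lookup only-j q∈ (sub p∈) =
      z , single (app ρ z) (proj₁ v) t p (trans (proj₂ v) e) p∈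
        (λ m∈ → All.lookup common (proj₂ (factor (app σ i) (ρ∶ i) z∈) m∈) (sub m∈)) p∉t

    σ₀⊆ : mon (app σ 0) ⊆ mon (app σ 0) ++ mon (app σ 1)
    σ₀⊆ = ∈-++⁺ˡ

    σ₁⊆ : mon (app σ 1) ⊆ mon (app σ 0) ++ mon (app σ 1)
    σ₁⊆ = ∈-++⁺ʳ (mon (app σ 0))

    common? : ∀ i j p → Dec (All (λ m → m ∈ mon (τ j) → m ∈ ([] , p) ∷ []) (mon (τ i)))
    common? i j p = All.all? (λ m → (m ∈ᵐ? mon (τ j)) →-dec (m ∈ᵐ? (([] , p) ∷ []))) (mon (τ i))

    only? : ∀ p j → Dec (All (λ q → ([] , p) ∈ mon (τ q) → q ≡ j) right)
    only? p j = All.all? (λ q → (([] , p) ∈ᵐ? mon (τ q)) →-dec (q ℕ.≟ j)) right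

    preimageOf : ∀ p → ∃[ z ] E ⊢ app ρ z ≈ var p
    preimageOf 0 = cell 0 2 0 (var 3) σ₀⊆ (here refl) refl (from-no (([] , 0) ∈ᵐ? mon (var 3)))
      (from-yes (common? 0 2 0)) (from-yes (only? 0 2))
    preimageOf 1 = cell 0 3 1 (var 4) σ₀⊆ (there (here refl)) refl (from-no (([] , 1) ∈ᵐ? mon (var 4)))
      (from-yes (common? 0 3 1)) (from-yes (only? 1 3))
    preimageOf 2 = cell 0 4 2 (var (5 + k)) σ₀⊆ (there (there (here refl))) refl
      (from-no (([] , 2) ∈ᵐ? mon (var (5 + k)))) (from-yes (common? 0 4 2)) (from-yes (only? 2 4))
    preimageOf 3 = cell 1 2 3 (var 0) σ₁⊆ (here refl) (⊕-comm _ _) (from-no (([] , 3) ∈ᵐ? mon (var 0)))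
      (from-yes (common? 1 2 3)) (from-yes (only? 3 2))
    preimageOf 4 = cell 1 3 4 (var 1) σ₁⊆ (there (here refl)) (⊕-comm _ _) (from-no (([] , 4) ∈ᵐ? mon (var 1)))
      (from-yes (common? 1 3 4)) (from-yes (only? 4 3))
    -- From `5` on `solution k` is the identity; this includes the sixth cell, `5 + k`.
    preimageOf p@(suc (suc (suc (suc (suc _))))) =
      let z , _ , e = preimage (app σ p) (ρ∶ p) in z , e

    -- With every variable hit, `ρ` is a permutation up to `≈`, and the inverse permutation leads
    -- back from `solution k` to `σ`.
    solution≲σ : solution k ≲ σ
    solution≲σ with π , inv ← invert 0 ρ (λ p _ → preimageOf p) =
      fromˢ , λ x → trans (≈-[] (app fromˢ) (sym (ρ∶ x)))
        (trans (≈-reflexive ([]-∘ (app σ x)))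
          (trans ([]-≈ (app σ x) back) (≈-reflexive ([]-var (app σ x)))))
      where
      open Renaming π
      back : ∀ z → E ⊢ app ρ z [ var ∘ from ] ≈ var z
      back z = trans
        (≈-[] (var ∘ from) (trans (≈-reflexive (≡.cong (app ρ) (≡.sym (from-to z)))) (inv (to z) z≤n)))
        (≈-reflexive (≡.cong var (from-to z)))

  -- Each solution is equivalent to the element of `S` below it. By the pigeonhole principle two of
  -- `n + 1` solutions would share that element and thus be comparable.
  excess-infinite : ∀ {S} → MinimalCompleteSet E excess S → Infinite S
  excess-infinite {S} (S⊆ , complete , _) (n , inverse) = clash (Fin.pigeonhole (ℕ.n<1+n n) (to ∘ s))
    where
    open Inverse inverse
    s : Fin (suc n) → ∃ S
    s i = let σ , σ∈ , _ = complete (solution (Fin.toℕ i)) (solution-unifies (Fin.toℕ i)) in σ , σ∈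
    s≲ : ∀ i → proj₁ (s i) ≲ solution (Fin.toℕ i)
    s≲ i = proj₂ (proj₂ (complete (solution (Fin.toℕ i)) (solution-unifies (Fin.toℕ i))))
    ≲s : ∀ i → solution (Fin.toℕ i) ≲ proj₁ (s i)
    ≲s i with ρ , ρ∶ ← s≲ i = Cells.solution≲σ (Fin.toℕ i) {proj₁ (s i)} {ρ} (S⊆ (proj₂ (s i))) ρ∶
    clash : ¬ (∃[ i ] ∃[ j ] (i Fin.< j × to (s i) ≡ to (s j)))
    clash (i , j , i<j , e) = Fin.<⇒≢ i<j (Fin.toℕ-injective (solution-injective
      (≲-trans {solution (Fin.toℕ i)} {proj₁ (s i)} {solution (Fin.toℕ j)} (≲s i)
        (≲-trans {proj₁ (s i)} {proj₁ (s j)} {solution (Fin.toℕ j)}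
          (≲-pointwise {proj₁ (s i)} {proj₁ (s j)} (λ x → ≈-reflexive (same x))) (s≲ j)))))
      where
      same : ∀ x → app (proj₁ (s i)) x ≡ app (proj₁ (s j)) x
      same x = ≡.trans (≡.sym (strictlyInverseʳ (s i) x))
        (≡.trans (≡.cong (λ c → app (proj₁ (from c)) x) e) (strictlyInverseʳ (s j) x))

  -- The type of the three theories.

  type-infinitary : TheoryHasType E infinitary
  type-infinitary =
    ( excess , (solution 0 , solution-unifies 0)
    , Representatives , representatives-minimalComplete
    , excess-infinite representatives-minimalComplete ) , worst
    where
    open Minimality excess
    worst : ∀ Γ → Solvable E Γ → ∀ t → ProblemHasType E Γ t → rank t ≤ 2
    worst Γ _ unitary    _ = z≤n
    worst Γ _ finitary   _ = s≤s z≤n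
    worst Γ _ infinitary _ = s≤s (s≤s z≤n)
    worst Γ _ zero    none = contradiction
      (Minimality.Representatives Γ , Minimality.representatives-minimalComplete Γ) none

theorem6p27 : ExcludedMiddle 0ℓ →
    TheoryHasType ACU infinitary ×
    ((r : ℕ) → .{{_ : NonZero r}} → TheoryHasType (FL₀ r) infinitary) ×
    ((r : ℕ) → .{{_ : NonZero r}} → TheoryHasType (ACUh r) infinitary)
theorem6p27 em =
  Instantiation.type-infinitary em ACU-adequate ,
  (λ r → Instantiation.type-infinitary em (Idempotent.adequate r)) ,
  (λ r → Instantiation.type-infinitary em (ACUh-adequate r))
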